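{- Let $p$ be a positive integer. Then for every real or complex number $x$, $$M(x,p) = e^x \int_0^x \varphi_{p+1}(t)\,\frac{dt}{t} = e^x \sum_{k=1}^{p+1} \frac{1}{k}\, S(p+1,k)\, x^k,$$ where $M(x,p)=\sum_{n=1}^{\infty}\left(1^p+2^p+\dots+n^p\right)\frac{x^n}{n!}$.
   Context: $S(m,k)$ denotes the Stirling numbers of the second kind. The exponential polynomials are $\varphi_m(x)=\sum_{k=0}^{m} S(m,k)x^k$ for integers $m\ge 0$, so $\varphi_0(x)=1$, $\varphi_1(x)=x$, $\varphi_2(x)=x^2+x$, $\varphi_3(x)=x^3+3x^2+x$. Since $S(p+1,0)=0$ for every positive integer $p$, $\varphi_{p+1}(t)/t$ is a polynomial in $t$. For complex $x$ the integral is taken along the line segment from $0$ to $x$. -}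

module Defs where

open import Algebra.Bundles using (CommutativeRing)
open import Data.Fin.Base using (Fin; toℕ; inject₁; fromℕ) renaming (zero to fzero; suc to fsuc)
open import Data.Integer.Base as ℤ using (ℤ; +_)
import Data.Integer.Properties as ℤP
open import Data.Nat.Base as ℕ using (ℕ; zero; suc; _!)
import Data.Nat.Properties as ℕP
open import Data.Product.Base using (∃; _×_; _,_; proj₁; proj₂)
open import Data.Rational.Base as Rat using (ℚ; 0ℚ; 1ℚ; ½)
import Data.Rational.Properties as ℚP
import Data.Rational.Unnormalised.Base as ℚᵘ
import Data.Rational.Unnormalised.Properties as ℚᵘP
open import Data.Rational.Solver using (module +-*-Solver)
open import Data.Sum.Base using (inj₁; inj₂; [_,_]′)
open import Relation.Binary.PropositionalEquality
  using (_≡_; refl; sym; trans; cong; cong₂; subst; subst₂)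

Eventually : (ℕ → Set) → Set
Eventually P = ∃ λ N → ∀ n → N ℕ.≤ n → P n

module Rational where
  open Rat hiding (ℚ; 0ℚ; 1ℚ; ½)
  open ℚP.≤-Reasoning

  Eventually-× : ∀ {P Q : ℕ → Set} → Eventually P → Eventually Q →
                 Eventually (λ n → P n × Q n)
  Eventually-× (M , p) (N , q) = M ℕ.⊔ N , λ n le →
    p n (ℕP.≤-trans (ℕP.m≤m⊔n M N) le) , q n (ℕP.≤-trans (ℕP.m≤n⊔m M N) le)

  half : ∀ {ε} → 0ℚ < ε → 0ℚ < ½ * ε
  half {ε} 0<ε = subst (_< ½ * ε) (ℚP.*-zeroʳ ½) (ℚP.*-monoʳ-<-pos ½ 0<ε)

  half+half : ∀ ε → ½ * ε + ½ * ε ≡ ε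
  half+half ε = trans (sym (ℚP.*-distribʳ-+ ε ½ ½)) (ℚP.*-identityˡ ε)

  0<+ : ∀ {a b} → 0ℚ < a → 0ℚ < b → 0ℚ < a + b
  0<+ = ℚP.+-mono-<

  shrink : ∀ {B ε} → 0ℚ < B → 0ℚ < ε → ∃ λ δ → 0ℚ < δ × B * δ ≡ ε
  shrink {B} {ε} 0<B 0<ε = 1/B * ε , positivity , eq
    where
    instance
      B-pos = positive 0<B
      B-nz = ℚP.pos⇒nonZero B
      1/B-pos = ℚP.1/pos⇒pos B
    1/B = 1/ B
    positivity : 0ℚ < 1/B * ε
    positivity = subst (_< 1/B * ε) (ℚP.*-zeroʳ 1/B) (ℚP.*-monoʳ-<-pos 1/B 0<ε)
    eq : B * (1/B * ε) ≡ ε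
    eq = trans (sym (ℚP.*-assoc B 1/B ε))
           (trans (cong (_* ε) (ℚP.*-inverseʳ B)) (ℚP.*-identityˡ ε))

  *-mono-nonNeg : ∀ {a b c d} → 0ℚ ≤ a → a ≤ b → 0ℚ ≤ c → c ≤ d → a * c ≤ b * d
  *-mono-nonNeg {a} {b} {c} {d} 0≤a a≤b 0≤c c≤d = begin
    a * c ≤⟨ ℚP.*-monoʳ-≤-nonNeg c {{nonNegative 0≤c}} a≤b ⟩
    b * c ≤⟨ ℚP.*-monoˡ-≤-nonNeg b {{nonNegative (ℚP.≤-trans 0≤a a≤b)}} c≤d ⟩
    b * d ∎

  ∣-∣-sym : ∀ a b → ∣ a - b ∣ ≡ ∣ b - a ∣
  ∣-∣-sym a b = trans (cong ∣_∣ (solve 2 (λ a b → a :- b := :- (b :- a)) refl a b))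
                      (ℚP.∣-p∣≡∣p∣ (b - a))
    where open +-*-Solver

  ∣a-a∣ : ∀ a → ∣ a - a ∣ ≡ 0ℚ
  ∣a-a∣ a = cong ∣_∣ (ℚP.+-inverseʳ a)

  triangle : ∀ a b c → ∣ a - c ∣ ≤ ∣ a - b ∣ + ∣ b - c ∣
  triangle a b c = subst (λ z → ∣ z ∣ ≤ ∣ a - b ∣ + ∣ b - c ∣)
    (solve 3 (λ a b c → (a :- b) :+ (b :- c) := a :- c) refl a b c)
    (ℚP.∣p+q∣≤∣p∣+∣q∣ (a - b) (b - c))
    where open +-*-Solver

  triangle-< : ∀ {a b c δ ε} → ∣ a - b ∣ < δ → ∣ b - c ∣ < ε → ∣ a - c ∣ < δ + ε
  triangle-< {a} {b} {c} p q = ℚP.≤-<-trans (triangle a b c) (ℚP.+-mono-< p q)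

  +-close : ∀ {a b c d δ ε} → ∣ a - c ∣ < δ → ∣ b - d ∣ < ε →
            ∣ (a + b) - (c + d) ∣ < δ + ε
  +-close {a} {b} {c} {d} p q = subst (λ z → ∣ z ∣ < _)
    (solve 4 (λ a b c d → (a :- c) :+ (b :- d) := (a :+ b) :- (c :+ d)) refl a b c d)
    (ℚP.≤-<-trans (ℚP.∣p+q∣≤∣p∣+∣q∣ (a - c) (b - d)) (ℚP.+-mono-< p q))
    where open +-*-Solver

  neg-close : ∀ a c → ∣ (- a) - (- c) ∣ ≡ ∣ a - c ∣
  neg-close a c = trans
    (cong ∣_∣ (solve 2 (λ a c → (:- a) :- (:- c) := :- (a :- c)) refl a c))
    (ℚP.∣-p∣≡∣p∣ (a - c))
    where open +-*-Solver

  ∣-∣≤ : ∀ {x y} → x ≤ y → - x ≤ y → ∣ x ∣ ≤ y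
  ∣-∣≤ {x} p q with ℚP.∣p∣≡p∨∣p∣≡-p x
  ... | inj₁ e = subst (_≤ _) (sym e) p
  ... | inj₂ e = subst (_≤ _) (sym e) q

  ∣∣-∣-close : ∀ a c → ∣ ∣ a ∣ - ∣ c ∣ ∣ ≤ ∣ a - c ∣
  ∣∣-∣-close a c = ∣-∣≤ (aux a c) (subst₂ _≤_ lemma (∣-∣-sym c a) (aux c a))
    where
    open +-*-Solver
    lemma : ∣ c ∣ - ∣ a ∣ ≡ - (∣ a ∣ - ∣ c ∣)
    lemma = solve 2 (λ a c → c :- a := :- (a :- c)) refl ∣ a ∣ ∣ c ∣
    aux : ∀ a c → ∣ a ∣ - ∣ c ∣ ≤ ∣ a - c ∣
    aux a c = subst (∣ a ∣ - ∣ c ∣ ≤_)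
      (solve 2 (λ x y → (x :+ y) :- y := x) refl ∣ a - c ∣ ∣ c ∣)
      (ℚP.+-monoˡ-≤ (- ∣ c ∣)
        (subst (λ z → ∣ z ∣ ≤ ∣ a - c ∣ + ∣ c ∣)
          (solve 2 (λ a c → (a :- c) :+ c := a) refl a c)
          (ℚP.∣p+q∣≤∣p∣+∣q∣ (a - c) c)))

  *-close : ∀ {B δ ε a b c d} → 0ℚ < B → B * δ ≡ ½ * ε →
            ∣ a ∣ ≤ B → ∣ d ∣ ≤ B → ∣ a - c ∣ < δ → ∣ b - d ∣ < δ →
            ∣ a * b - c * d ∣ < ε
  *-close {B} {δ} {ε} {a} {b} {c} {d} 0<B e a≤B d≤B p q = begin-strict
    ∣ a * b - c * d ∣
      ≡⟨ cong ∣_∣ (solve 4 (λ a b c d → a :* b :- c :* d := a :* (b :- d) :+ d :* (a :- c))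
                     refl a b c d) ⟩
    ∣ a * (b - d) + d * (a - c) ∣
      ≤⟨ ℚP.∣p+q∣≤∣p∣+∣q∣ (a * (b - d)) (d * (a - c)) ⟩
    ∣ a * (b - d) ∣ + ∣ d * (a - c) ∣
      <⟨ ℚP.+-mono-< (piece a a≤B q) (piece d d≤B p) ⟩
    ½ * ε + ½ * ε
      ≡⟨ half+half ε ⟩
    ε ∎
    where
    open +-*-Solver using (solve; _:*_; _:-_; _:+_; _:=_)
    piece : ∀ u {v} → ∣ u ∣ ≤ B → ∣ v ∣ < δ → ∣ u * v ∣ < ½ * ε
    piece u {v} u≤B v<δ = begin-strict
      ∣ u * v ∣     ≡⟨ ℚP.∣p*q∣≡∣p∣*∣q∣ u v ⟩
      ∣ u ∣ * ∣ v ∣ ≤⟨ ℚP.*-monoʳ-≤-nonNeg ∣ v ∣ {{ℚP.∣-∣-nonNeg v}} u≤B ⟩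
      B * ∣ v ∣     <⟨ ℚP.*-monoʳ-<-pos B {{positive 0<B}} v<δ ⟩
      B * δ         ≡⟨ e ⟩
      ½ * ε ∎

  inv : (n : ℕ) .{{_ : ℕ.NonZero n}} → ℚ
  inv n = + 1 / n

  toℚᵘ-/ : ∀ i d → toℚᵘ (i / suc d) ℚᵘ.≃ ℚᵘ.mkℚᵘ i d
  toℚᵘ-/ i d = ℚP.toℚᵘ-fromℚᵘ (ℚᵘ.mkℚᵘ i d)

  /-mono-≤ : ∀ {i j d e} → i ℤ.* + suc e ℤ.≤ j ℤ.* + suc d → i / suc d ≤ j / suc e
  /-mono-≤ {i} {j} {d} {e} p = ℚP.toℚᵘ-cancel-≤
    (ℚᵘP.≤-respˡ-≃ (ℚᵘP.≃-sym (toℚᵘ-/ i d))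
      (ℚᵘP.≤-respʳ-≃ (ℚᵘP.≃-sym (toℚᵘ-/ j e)) (ℚᵘ.*≤* p)))

  0<inv : ∀ n .{{_ : ℕ.NonZero n}} → 0ℚ < inv n
  0<inv n = ℚP.positive⁻¹ (inv n) {{ℚP.normalize-pos 1 n}}

  inv-anti : ∀ {m n} → m ℕ.≤ n → inv (suc n) ≤ inv (suc m)
  inv-anti {m} {n} m≤n = /-mono-≤ {+ 1} {+ 1} {n} {m}
    (ℤP.*-monoˡ-≤-nonNeg (+ 1) (ℤ.+≤+ (ℕ.s≤s m≤n)))

  ½inv : ∀ n → ½ * inv (suc n) ≤ inv (suc (suc n))
  ½inv n = ℚP.toℚᵘ-cancel-≤
    (ℚᵘP.≤-respˡ-≃ (ℚᵘP.≃-sym left)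
      (ℚᵘP.≤-respʳ-≃ (ℚᵘP.≃-sym (toℚᵘ-/ (+ 1) (suc n)))
        (ℚᵘ.*≤* (ℤ.+≤+ ineq))))
    where
    left : toℚᵘ (½ * inv (suc n)) ℚᵘ.≃ ℚᵘ.mkℚᵘ (+ 1) 1 ℚᵘ.* ℚᵘ.mkℚᵘ (+ 1) n
    left = ℚᵘP.≃-trans (ℚP.toℚᵘ-homo-* ½ (inv (suc n)))
                       (ℚᵘP.*-congˡ {ℚᵘ.mkℚᵘ (+ 1) 1} (toℚᵘ-/ (+ 1) n))
    ineq : 1 ℕ.* suc (suc n) ℕ.≤ 1 ℕ.* (2 ℕ.* suc n)
    ineq = ℕP.*-monoʳ-≤ 1 (ℕ.s≤s (ℕP.≤-trans (ℕP.≤-reflexive (sym (ℕP.+-identityʳ (suc n))))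
             (ℕP.m≤n+m (suc n ℕ.+ 0) n)))

  small : ∀ {ε} → 0ℚ < ε → ∃ λ n → inv (suc n) < ε
  small {mkℚ (ℤ.+ suc n) d _} 0<ε = suc d ,
    ℚP.toℚᵘ-cancel-< (ℚᵘP.<-respˡ-≃ (ℚᵘP.≃-sym (toℚᵘ-/ (+ 1) (suc d)))
      (ℚᵘ.*<* (ℤ.+<+ ineq)))
    where
    ineq : 1 ℕ.* suc d ℕ.< suc n ℕ.* suc (suc d)
    ineq = ℕP.<-≤-trans (ℕP.≤-<-trans (ℕP.≤-reflexive (ℕP.*-identityˡ (suc d))) (ℕP.n<1+n (suc d)))
             (ℕP.m≤m+n (suc (suc d)) _)
  small {mkℚ (ℤ.+ zero) d _} (*<* (ℤ.+<+ ()))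
  small {mkℚ ℤ.-[1+ n ] d _} (*<* ())

  large : ∀ q → ∃ λ c → q ≤ + c / 1
  large q@(mkℚ n d _) = ℤ.∣ n ∣ ,
    ℚP.toℚᵘ-cancel-≤ (ℚᵘP.≤-respʳ-≃ (ℚᵘP.≃-sym (toℚᵘ-/ (+ ℤ.∣ n ∣) 0))
      (ℚᵘ.*≤* (subst₂ ℤ._≤_ (sym (ℤP.*-identityʳ n)) (ℤP.pos-* ℤ.∣ n ∣ (suc d))
        (below n))))
    where
    below : ∀ n → n ℤ.≤ + (ℤ.∣ n ∣ ℕ.* suc d)
    below (ℤ.+ k)    = ℤ.+≤+ (ℕP.m≤m*n k (suc d))
    below ℤ.-[1+ k ] = ℤ.-≤+

  inv-* : ∀ m n .{{_ : ℕ.NonZero m}} .{{_ : ℕ.NonZero n}} .{{_ : ℕ.NonZero (m ℕ.* n)}} →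
          inv (m ℕ.* n) ≡ inv m * inv n
  inv-* (suc m) (suc n) = ℚP.toℚᵘ-injective
    (ℚᵘP.≃-trans (toℚᵘ-/ (+ 1) (n ℕ.+ m ℕ.* suc n))
      (ℚᵘP.≃-sym (ℚᵘP.≃-trans (ℚP.toℚᵘ-homo-* (inv (suc m)) (inv (suc n)))
        (ℚᵘP.*-cong (toℚᵘ-/ (+ 1) m) (toℚᵘ-/ (+ 1) n)))))

  c*inv≤½ : ∀ c n → 2 ℕ.* c ℕ.≤ suc n → (+ c / 1) * inv (suc n) ≤ ½
  c*inv≤½ c n p = ℚP.toℚᵘ-cancel-≤ (ℚᵘP.≤-respˡ-≃ (ℚᵘP.≃-sym left) (ℚᵘ.*≤* ineq))
    where
    left : toℚᵘ ((+ c / 1) * inv (suc n)) ℚᵘ.≃ ℚᵘ.mkℚᵘ (+ c) 0 ℚᵘ.* ℚᵘ.mkℚᵘ (+ 1) n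
    left = ℚᵘP.≃-trans (ℚP.toℚᵘ-homo-* (+ c / 1) (inv (suc n)))
                       (ℚᵘP.*-cong (toℚᵘ-/ (+ c) 0) (toℚᵘ-/ (+ 1) n))
    ineq : (+ c ℤ.* + 1) ℤ.* + 2 ℤ.≤ + 1 ℤ.* + (1 ℕ.* suc n)
    ineq = subst₂ ℤ._≤_
      (trans (cong +_ (ℕP.*-comm 2 c)) (trans (ℤP.pos-* c 2) (cong (ℤ._* + 2) (sym (ℤP.*-identityʳ (+ c))))))
      (trans (cong +_ (sym (ℕP.*-identityˡ (suc n)))) (sym (ℤP.*-identityˡ _)))
      (ℤ.+≤+ p)

-- Cauchy sequences of rationals, identified up to null sequences by _≈ᵣ_ and
-- with termwise operations. All operations are defined by copatterns (and
-- without eta), so that they do not unfold during unification.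
record ℝ : Set where
  no-eta-equality
  field
    seq    : ℕ → ℚ
    cauchy : ∀ ε → 0ℚ Rat.< ε → ∃ λ N → ∀ m n → N ℕ.≤ m → N ℕ.≤ n →
             Rat.∣ seq m Rat.- seq n ∣ Rat.< ε

open ℝ public

module Real where
  open Rat hiding (ℚ; 0ℚ; 1ℚ; ½)
  open Rational

  infix  4 _≈ᵣ_ _≤ᵣ_
  infixl 6 _+ᵣ_
  infixl 7 _*ᵣ_
  infix  8 -ᵣ_

  -- Records rather than function types, so that the endpoints can be inferred
  -- from a proof.
  record _≈ᵣ_ (x y : ℝ) : Set where
    constructor mk≈
    field
      close : ∀ ε → 0ℚ < ε → Eventually λ n → ∣ seq x n - seq y n ∣ < ε

  record _≤ᵣ_ (x y : ℝ) : Set where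
    constructor mk≤
    field
      below : ∀ ε → 0ℚ < ε → Eventually λ n → seq x n < seq y n + ε

  open _≈ᵣ_ public
  open _≤ᵣ_ public

  fromℚ : ℚ → ℝ
  seq    (fromℚ q) _ = q
  cauchy (fromℚ q) ε 0<ε = 0 , λ _ _ _ _ → subst (_< ε) (sym (∣a-a∣ q)) 0<ε

  _+ᵣ_ : ℝ → ℝ → ℝ
  seq    (x +ᵣ y) n = seq x n + seq y n
  cauchy (x +ᵣ y) ε 0<ε =
    let M , p = cauchy x (½ * ε) (half 0<ε)
        N , q = cauchy y (½ * ε) (half 0<ε)
    in M ℕ.⊔ N , λ m n le le′ → subst (_ <_) (half+half ε)
         (+-close {seq x m} {seq y m} {seq x n} {seq y n}
           (p m n (ℕP.m⊔n≤o⇒m≤o M N le) (ℕP.m⊔n≤o⇒m≤o M N le′))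
           (q m n (ℕP.m⊔n≤o⇒n≤o M N le) (ℕP.m⊔n≤o⇒n≤o M N le′)))

  -ᵣ_ : ℝ → ℝ
  seq    (-ᵣ x) n = - seq x n
  cauchy (-ᵣ x) ε 0<ε =
    let M , p = cauchy x ε 0<ε
    in M , λ m n le le′ →
         subst (_< ε) (sym (neg-close (seq x m) (seq x n))) (p m n le le′)

  ∣_∣ᵣ : ℝ → ℝ
  seq    ∣ x ∣ᵣ n = ∣ seq x n ∣
  cauchy ∣ x ∣ᵣ ε 0<ε =
    let M , p = cauchy x ε 0<ε
    in M , λ m n le le′ →
         ℚP.≤-<-trans (∣∣-∣-close (seq x m) (seq x n)) (p m n le le′)

  bounded : ∀ x → ∃ λ B → 0ℚ < B × Eventually λ n → ∣ seq x n ∣ ≤ B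
  bounded x = B , ℚP.+-mono-≤-< (ℚP.0≤∣p∣ a) 0<1 , N , bound
    where
    0<1 : 0ℚ < 1ℚ
    0<1 = ℚP.positive⁻¹ 1ℚ
    N = proj₁ (cauchy x 1ℚ 0<1)
    a = seq x N
    B = ∣ a ∣ + 1ℚ
    bound : ∀ n → N ℕ.≤ n → ∣ seq x n ∣ ≤ B
    bound n le = subst (λ z → ∣ z ∣ ≤ B)
      (solve 2 (λ a b → a :+ (b :- a) := b) refl a (seq x n))
      (ℚP.≤-trans (ℚP.∣p+q∣≤∣p∣+∣q∣ a (seq x n - a))
        (ℚP.+-monoʳ-≤ ∣ a ∣ (ℚP.<⇒≤ (proj₂ (cauchy x 1ℚ 0<1) n N le ℕP.≤-refl))))
      where open +-*-Solver

  bounded₂ : ∀ x y → ∃ λ B → 0ℚ < B ×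
             Eventually λ n → ∣ seq x n ∣ ≤ B × ∣ seq y n ∣ ≤ B
  bounded₂ x y =
    let A , 0<A , M , p = bounded x
        B , 0<B , N , q = bounded y
    in A + B , 0<+ 0<A 0<B ,
       Eventually-×
         (M , λ n le → ℚP.≤-trans (p n le)
            (subst (_≤ A + B) (ℚP.+-identityʳ A) (ℚP.+-monoʳ-≤ A (ℚP.<⇒≤ 0<B))))
         (N , λ n le → ℚP.≤-trans (q n le)
            (subst (_≤ A + B) (ℚP.+-identityˡ B) (ℚP.+-monoˡ-≤ B (ℚP.<⇒≤ 0<A))))

  _*ᵣ_ : ℝ → ℝ → ℝ
  seq    (x *ᵣ y) n = seq x n * seq y n
  cauchy (x *ᵣ y) ε 0<ε =
    let B , 0<B , K , b = bounded₂ x y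
        δ , 0<δ , e = shrink 0<B (half 0<ε)
        M , p = cauchy x δ 0<δ
        N , q = cauchy y δ 0<δ
    in K ℕ.⊔ (M ℕ.⊔ N) , λ m n le le′ →
       let r  = ℕP.m⊔n≤o⇒n≤o K (M ℕ.⊔ N) le
           r′ = ℕP.m⊔n≤o⇒n≤o K (M ℕ.⊔ N) le′
       in *-close {B} {δ} {ε} {seq x m} {seq y m} {seq x n} {seq y n} 0<B e
            (proj₁ (b m (ℕP.m⊔n≤o⇒m≤o K _ le)))
            (proj₂ (b n (ℕP.m⊔n≤o⇒m≤o K _ le′)))
            (p m n (ℕP.m⊔n≤o⇒m≤o M N r) (ℕP.m⊔n≤o⇒m≤o M N r′))
            (q m n (ℕP.m⊔n≤o⇒n≤o M N r) (ℕP.m⊔n≤o⇒n≤o M N r′))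

  termwise : ∀ {x y} → (∀ n → seq x n ≡ seq y n) → x ≈ᵣ y
  termwise {x} {y} e = mk≈ λ ε 0<ε → 0 , λ n _ →
    subst (_< ε) (trans (sym (∣a-a∣ (seq x n))) (cong (λ z → ∣ seq x n - z ∣) (e n))) 0<ε

  ≈ᵣ-sym : ∀ {x y} → x ≈ᵣ y → y ≈ᵣ x
  ≈ᵣ-sym {x} {y} p = mk≈ λ ε 0<ε →
    let N , q = close p ε 0<ε
    in N , λ n le → subst (_< ε) (∣-∣-sym (seq x n) (seq y n)) (q n le)

  ≈ᵣ-trans : ∀ {x y z} → x ≈ᵣ y → y ≈ᵣ z → x ≈ᵣ z
  ≈ᵣ-trans {x} {y} {z} p q = mk≈ λ ε 0<ε →
    let N , r = Eventually-× (close p (½ * ε) (half 0<ε)) (close q (½ * ε) (half 0<ε))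
    in N , λ n le → subst (_ <_) (half+half ε)
         (triangle-< {seq x n} {seq y n} {seq z n} (proj₁ (r n le)) (proj₂ (r n le)))

  +ᵣ-cong : ∀ {x y u v} → x ≈ᵣ y → u ≈ᵣ v → x +ᵣ u ≈ᵣ y +ᵣ v
  +ᵣ-cong {x} {y} {u} {v} p q = mk≈ λ ε 0<ε →
    let N , r = Eventually-× (close p (½ * ε) (half 0<ε)) (close q (½ * ε) (half 0<ε))
    in N , λ n le → subst (_ <_) (half+half ε)
         (+-close {seq x n} {seq u n} {seq y n} {seq v n} (proj₁ (r n le)) (proj₂ (r n le)))

  -ᵣ-cong : ∀ {x y} → x ≈ᵣ y → -ᵣ x ≈ᵣ -ᵣ y
  -ᵣ-cong {x} {y} p = mk≈ λ ε 0<ε →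
    let N , q = close p ε 0<ε
    in N , λ n le → subst (_< ε) (sym (neg-close (seq x n) (seq y n))) (q n le)

  *ᵣ-cong : ∀ {x y u v} → x ≈ᵣ y → u ≈ᵣ v → x *ᵣ u ≈ᵣ y *ᵣ v
  *ᵣ-cong {x} {y} {u} {v} p q = mk≈ λ ε 0<ε →
    let B , 0<B , b = bounded₂ x v
        δ , 0<δ , e = shrink 0<B (half 0<ε)
        N , r = Eventually-× b (Eventually-× (close p δ 0<δ) (close q δ 0<δ))
    in N , λ n le →
       let (bx , bv) , (xy , uv) = r n le
       in *-close {B} {δ} {ε} {seq x n} {seq u n} {seq y n} {seq v n} 0<B e bx bv xy uv

  ℝ-commutativeRing : CommutativeRing _ _
  ℝ-commutativeRing = record
    { Carrier = ℝ ; _≈_ = _≈ᵣ_ ; _+_ = _+ᵣ_ ; _*_ = _*ᵣ_ ; -_ = -ᵣ_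
    ; 0# = fromℚ 0ℚ ; 1# = fromℚ 1ℚ
    ; isCommutativeRing = record
      { isRing = record
        { +-isAbelianGroup = record
          { isGroup = record
            { isMonoid = record
              { isSemigroup = record
                { isMagma = record
                  { isEquivalence = record
                    { refl  = termwise λ _ → refl
                    ; sym   = ≈ᵣ-sym
                    ; trans = ≈ᵣ-trans
                    }
                  ; ∙-cong = +ᵣ-cong
                  }
                ; assoc = λ x y z → termwise λ n →
                    ℚP.+-assoc (seq x n) (seq y n) (seq z n)
                }
              ; identity = (λ x → termwise λ n → ℚP.+-identityˡ (seq x n))
                         , (λ x → termwise λ n → ℚP.+-identityʳ (seq x n))
              }
            ; inverse = (λ x → termwise λ n → ℚP.+-inverseˡ (seq x n))
                      , (λ x → termwise λ n → ℚP.+-inverseʳ (seq x n))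
            ; ⁻¹-cong = -ᵣ-cong
            }
          ; comm = λ x y → termwise λ n → ℚP.+-comm (seq x n) (seq y n)
          }
        ; *-cong = *ᵣ-cong
        ; *-assoc = λ x y z → termwise λ n →
            ℚP.*-assoc (seq x n) (seq y n) (seq z n)
        ; *-identity = (λ x → termwise λ n → ℚP.*-identityˡ (seq x n))
                     , (λ x → termwise λ n → ℚP.*-identityʳ (seq x n))
        ; distrib = (λ x y z → termwise λ n →
                       ℚP.*-distribˡ-+ (seq x n) (seq y n) (seq z n))
                  , (λ x y z → termwise λ n →
                       ℚP.*-distribʳ-+ (seq x n) (seq y n) (seq z n))
        }
      ; *-comm = λ x y → termwise λ n → ℚP.*-comm (seq x n) (seq y n)
      }
    }

  open CommutativeRing ℝ-commutativeRing public
    using () renaming (_-_ to _-ᵣ_; 0# to 0ᵣ; 1# to 1ᵣ)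

  IsCauchy : (ℕ → ℝ) → Set
  IsCauchy s = ∀ ε → 0ℚ < ε → ∃ λ N → ∀ m n → N ℕ.≤ m → N ℕ.≤ n →
               ∣ s m -ᵣ s n ∣ᵣ ≤ᵣ fromℚ ε

  -- The n-th term of the limit is a rational within 1/(n+1) of s n.
  module Limit (s : ℕ → ℝ) (c : IsCauchy s) where
    modulus : ∀ n → ∃ λ K → ∀ i j → K ℕ.≤ i → K ℕ.≤ j →
              ∣ seq (s n) i - seq (s n) j ∣ < inv (suc n)
    modulus n = cauchy (s n) (inv (suc n)) (0<inv (suc n))

    K : ℕ → ℕ
    K n = proj₁ (modulus n)

    diagonal : ℕ → ℚ
    diagonal n = seq (s n) (K n)

    quarters : ∀ ε → ((½ * (½ * ε)) + ((½ * (½ * ε)) + (½ * (½ * ε)))) + ½ * (½ * ε) ≡ ε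
    quarters ε = trans
      (solve 1 (λ q → (q :+ (q :+ q)) :+ q := (q :+ q) :+ (q :+ q)) refl (½ * (½ * ε)))
      (trans (cong₂ _+_ (half+half (½ * ε)) (half+half (½ * ε))) (half+half ε))
      where open +-*-Solver

    near : ∀ ε → 0ℚ < ε → ∃ λ N → ∀ m n → N ℕ.≤ m → N ℕ.≤ n → ∀ i → K m ℕ.≤ i →
           ∣ seq (s m) i - diagonal n ∣ < ε
    near ε 0<ε = A ℕ.⊔ N , bound
      where
      q = ½ * (½ * ε)
      0<q : 0ℚ < q
      0<q = half (half 0<ε)
      A = proj₁ (small 0<q)
      N = proj₁ (c q 0<q)
      inv<q : ∀ n → A ℕ.≤ n → inv (suc n) < q
      inv<q n le = ℚP.≤-<-trans (inv-anti le) (proj₂ (small 0<q))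
      bound : ∀ m n → A ℕ.⊔ N ℕ.≤ m → A ℕ.⊔ N ℕ.≤ n → ∀ i → K m ℕ.≤ i →
              ∣ seq (s m) i - diagonal n ∣ < ε
      bound m n le le′ i Km≤i = subst (_ <_) (quarters ε)
        (triangle-< {seq (s m) i} {seq (s n) k} {diagonal n}
          (triangle-< {seq (s m) i} {seq (s m) k} {seq (s n) k}
            (ℚP.<-trans (proj₂ (modulus m) i k Km≤i Km≤k)
                        (inv<q m (ℕP.m⊔n≤o⇒m≤o A N le)))
            (proj₂ mid k J≤k))
          (ℚP.<-trans (proj₂ (modulus n) k (K n) Kn≤k ℕP.≤-refl)
                      (inv<q n (ℕP.m⊔n≤o⇒m≤o A N le′))))
        where
        mid = below (proj₂ (c q 0<q) m n (ℕP.m⊔n≤o⇒n≤o A N le) (ℕP.m⊔n≤o⇒n≤o A N le′)) q 0<q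
        k = proj₁ mid ℕ.⊔ (K m ℕ.⊔ K n)
        J≤k : proj₁ mid ℕ.≤ k
        J≤k = ℕP.m≤m⊔n (proj₁ mid) (K m ℕ.⊔ K n)
        Km≤k : K m ℕ.≤ k
        Km≤k = ℕP.≤-trans (ℕP.m≤m⊔n (K m) (K n)) (ℕP.m≤n⊔m (proj₁ mid) _)
        Kn≤k : K n ℕ.≤ k
        Kn≤k = ℕP.≤-trans (ℕP.m≤n⊔m (K m) (K n)) (ℕP.m≤n⊔m (proj₁ mid) _)

    lim : ℝ
    seq    lim = diagonal
    cauchy lim ε 0<ε =
      let N , p = near ε 0<ε
      in N , λ m n le le′ → p m n le le′ (K m) ℕP.≤-refl

    lim-converges : ∀ ε → 0ℚ < ε → Eventually λ n →
                    Eventually λ i → ∣ seq (s n) i - seq lim i ∣ < ε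
    lim-converges ε 0<ε =
      let N , p = near ε 0<ε
      in N , λ n le → N ℕ.⊔ K n , λ i le′ →
           p n i le (ℕP.m⊔n≤o⇒m≤o N (K n) le′) i (ℕP.m⊔n≤o⇒n≤o N (K n) le′)

open Real public

record ℂ : Set where
  no-eta-equality
  field
    re im : ℝ

open ℂ public

module Complex where
  infix  4 _≈_

  -- A record rather than a pair, so that the endpoints can be inferred from a
  -- proof.
  record _≈_ (z w : ℂ) : Set where
    constructor _,ᶜ_
    field
      re≈ : re z ≈ᵣ re w
      im≈ : im z ≈ᵣ im w

  open _≈_ public

  fromℝ : ℝ → ℂ
  re (fromℝ x) = x
  im (fromℝ x) = 0ᵣ

  fromℚᶜ : ℚ → ℂ
  fromℚᶜ q = fromℝ (fromℚ q)

  private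
    module R = CommutativeRing ℝ-commutativeRing

    _⊕_ : ℂ → ℂ → ℂ
    re (z ⊕ w) = re z +ᵣ re w
    im (z ⊕ w) = im z +ᵣ im w

    _⊛_ : ℂ → ℂ → ℂ
    re (z ⊛ w) = re z *ᵣ re w -ᵣ im z *ᵣ im w
    im (z ⊛ w) = re z *ᵣ im w +ᵣ im z *ᵣ re w

    ⊖_ : ℂ → ℂ
    re (⊖ z) = -ᵣ re z
    im (⊖ z) = -ᵣ im z

    termwiseᶜ : ∀ {z w} → (∀ n → seq (re z) n ≡ seq (re w) n) →
                (∀ n → seq (im z) n ≡ seq (im w) n) → z ≈ w
    termwiseᶜ {z} {w} p q = termwise {re z} {re w} p ,ᶜ termwise {im z} {im w} q

    ⊛-cong : ∀ {z w u v} → z ≈ w → u ≈ v → (z ⊛ u) ≈ (w ⊛ v)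
    ⊛-cong (a ,ᶜ b) (c ,ᶜ d) =
      R.+-cong (R.*-cong a c) (R.-‿cong (R.*-cong b d)) ,ᶜ
      R.+-cong (R.*-cong a d) (R.*-cong b c)

    module _ where
      open Rat using () renaming (_+_ to _+q_; _*_ to _*q_; _-_ to _-q_)
      open +-*-Solver

      assoc-re : ∀ a b c d e f →
        (a *q c -q b *q d) *q e -q (a *q d +q b *q c) *q f ≡
        a *q (c *q e -q d *q f) -q b *q (c *q f +q d *q e)
      assoc-re = solve 6 (λ a b c d e f →
        (a :* c :- b :* d) :* e :- (a :* d :+ b :* c) :* f :=
        a :* (c :* e :- d :* f) :- b :* (c :* f :+ d :* e)) refl

      assoc-im : ∀ a b c d e f →
        (a *q c -q b *q d) *q f +q (a *q d +q b *q c) *q e ≡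
        a *q (c *q f +q d *q e) +q b *q (c *q e -q d *q f)
      assoc-im = solve 6 (λ a b c d e f →
        (a :* c :- b :* d) :* f :+ (a :* d :+ b :* c) :* e :=
        a :* (c :* f :+ d :* e) :+ b :* (c :* e :- d :* f)) refl

      comm-re : ∀ a b c d → a *q c -q b *q d ≡ c *q a -q d *q b
      comm-re = solve 4 (λ a b c d → a :* c :- b :* d := c :* a :- d :* b) refl

      comm-im : ∀ a b c d → a *q d +q b *q c ≡ c *q b +q d *q a
      comm-im = solve 4 (λ a b c d → a :* d :+ b :* c := c :* b :+ d :* a) refl

      identity-re : ∀ a b → 1ℚ *q a -q 0ℚ *q b ≡ a
      identity-re = solve 2 (λ a b → con 1ℚ :* a :- con 0ℚ :* b := a) refl

      identity-im : ∀ a b → 1ℚ *q b +q 0ℚ *q a ≡ b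
      identity-im = solve 2 (λ a b → con 1ℚ :* b :+ con 0ℚ :* a := b) refl

      distrib-re : ∀ a b c d e f →
        a *q (c +q e) -q b *q (d +q f) ≡ (a *q c -q b *q d) +q (a *q e -q b *q f)
      distrib-re = solve 6 (λ a b c d e f →
        a :* (c :+ e) :- b :* (d :+ f) := (a :* c :- b :* d) :+ (a :* e :- b :* f)) refl

      distrib-im : ∀ a b c d e f →
        a *q (d +q f) +q b *q (c +q e) ≡ (a *q d +q b *q c) +q (a *q f +q b *q e)
      distrib-im = solve 6 (λ a b c d e f →
        a :* (d :+ f) :+ b :* (c :+ e) := (a :* d :+ b :* c) :+ (a :* f :+ b :* e)) refl

    ⊛-assoc : ∀ x y z → ((x ⊛ y) ⊛ z) ≈ (x ⊛ (y ⊛ z))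
    ⊛-assoc x y z = termwiseᶜ
      (λ n → assoc-re (seq (re x) n) (seq (im x) n) (seq (re y) n) (seq (im y) n)
               (seq (re z) n) (seq (im z) n))
      (λ n → assoc-im (seq (re x) n) (seq (im x) n) (seq (re y) n) (seq (im y) n)
               (seq (re z) n) (seq (im z) n))

    ⊛-comm : ∀ x y → (x ⊛ y) ≈ (y ⊛ x)
    ⊛-comm x y = termwiseᶜ
      (λ n → comm-re (seq (re x) n) (seq (im x) n) (seq (re y) n) (seq (im y) n))
      (λ n → comm-im (seq (re x) n) (seq (im x) n) (seq (re y) n) (seq (im y) n))

    ⊛-identityˡ : ∀ x → (fromℝ 1ᵣ ⊛ x) ≈ x
    ⊛-identityˡ x = termwiseᶜ
      (λ n → identity-re (seq (re x) n) (seq (im x) n))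
      (λ n → identity-im (seq (re x) n) (seq (im x) n))

    ⊛-distribˡ : ∀ x y z → (x ⊛ (y ⊕ z)) ≈ ((x ⊛ y) ⊕ (x ⊛ z))
    ⊛-distribˡ x y z = termwiseᶜ
      (λ n → distrib-re (seq (re x) n) (seq (im x) n) (seq (re y) n) (seq (im y) n)
               (seq (re z) n) (seq (im z) n))
      (λ n → distrib-im (seq (re x) n) (seq (im x) n) (seq (re y) n) (seq (im y) n)
               (seq (re z) n) (seq (im z) n))

    ≈-trans : ∀ {x y z} → x ≈ y → y ≈ z → x ≈ z
    ≈-trans (a ,ᶜ b) (c ,ᶜ d) = R.trans a c ,ᶜ R.trans b d

    ⊕-cong : ∀ {z w u v} → z ≈ w → u ≈ v → (z ⊕ u) ≈ (w ⊕ v)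
    ⊕-cong (a ,ᶜ b) (c ,ᶜ d) = R.+-cong a c ,ᶜ R.+-cong b d

  ℂ-commutativeRing : CommutativeRing _ _
  ℂ-commutativeRing = record
    { Carrier = ℂ ; _≈_ = _≈_ ; _+_ = _⊕_ ; _*_ = _⊛_ ; -_ = ⊖_
    ; 0# = fromℝ 0ᵣ ; 1# = fromℝ 1ᵣ
    ; isCommutativeRing = record
      { isRing = record
        { +-isAbelianGroup = record
          { isGroup = record
            { isMonoid = record
              { isSemigroup = record
                { isMagma = record
                  { isEquivalence = record
                    { refl  = R.refl ,ᶜ R.refl
                    ; sym   = λ (a ,ᶜ b) → R.sym a ,ᶜ R.sym b
                    ; trans = ≈-trans
                    }
                  ; ∙-cong = ⊕-cong
                  }
                ; assoc = λ x y z → R.+-assoc (re x) (re y) (re z) ,ᶜ R.+-assoc (im x) (im y) (im z)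
                }
              ; identity = (λ x → R.+-identityˡ (re x) ,ᶜ R.+-identityˡ (im x))
                         , (λ x → R.+-identityʳ (re x) ,ᶜ R.+-identityʳ (im x))
              }
            ; inverse = (λ x → R.-‿inverseˡ (re x) ,ᶜ R.-‿inverseˡ (im x))
                      , (λ x → R.-‿inverseʳ (re x) ,ᶜ R.-‿inverseʳ (im x))
            ; ⁻¹-cong = λ (a ,ᶜ b) → R.-‿cong a ,ᶜ R.-‿cong b
            }
          ; comm = λ x y → R.+-comm (re x) (re y) ,ᶜ R.+-comm (im x) (im y)
          }
        ; *-cong = ⊛-cong
        ; *-assoc = ⊛-assoc
        ; *-identity = ⊛-identityˡ
                     , λ x → ≈-trans (⊛-comm x (fromℝ 1ᵣ)) (⊛-identityˡ x)
        ; distrib = ⊛-distribˡ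
                  , λ x y z → ≈-trans (⊛-comm (y ⊕ z) x)
                      (≈-trans (⊛-distribˡ x y z) (⊕-cong (⊛-comm x y) (⊛-comm x z)))
        }
      ; *-comm = ⊛-comm
      }
    }

open Complex public hiding (_≈_)
open CommutativeRing ℂ-commutativeRing public
  using (_≈_; _+_; _*_; _-_; 0#; 1#)
open import Algebra.Properties.Semiring.Exp (CommutativeRing.semiring ℂ-commutativeRing) public
  using (_^_)
open import Algebra.Properties.Monoid.Sum (CommutativeRing.+-monoid ℂ-commutativeRing) public
  using (sum; sum-syntax; sum⁺-syntax)

module Convergence where
  -- The series ∑ₖ f k, k ≥ 0, has partial sums ∑_{k<n} f k.
  partialSum : (ℕ → ℂ) → ℕ → ℂ
  partialSum f n = ∑[ k < n ] f (toℕ k)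

  normSq : ℂ → ℝ
  normSq z = re z *ᵣ re z +ᵣ im z *ᵣ im z

  -- |z| ≤ ε for rational ε ≥ 0, without taking square roots.
  ∥_∥≤_ : ℂ → ℚ → Set
  ∥ z ∥≤ ε = normSq z ≤ᵣ fromℚ (ε Rat.* ε)

  _⟶_ : (ℕ → ℂ) → ℂ → Set
  s ⟶ l = ∀ ε → 0ℚ Rat.< ε → Eventually λ n → ∥ s n - l ∥≤ ε

  SumsTo : (ℕ → ℂ) → ℂ → Set
  SumsTo f S = partialSum f ⟶ S

open Convergence public

invFact : ℕ → ℚ
invFact n = (+ 1 Rat./ (n !)) {{n ℕP.!≢0}}

expTerm : ℂ → ℕ → ℂ
expTerm z n = fromℚᶜ (invFact n) * z ^ n

-- Convergence of the exponential series, by comparison of its n-th rational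
-- approximations with a geometric series in the norm |re| + |im|.
module ExpConvergence (z : ℂ) where
  open Rat hiding (ℚ; 0ℚ; 1ℚ; ½; _+_; _*_; _-_)
  open Rat using () renaming (_+_ to _⊞_; _*_ to _⊠_; _-_ to _⊟_)
  open Rational
  open ℚP.≤-Reasoning

  norm₁ : ℂ → ℕ → ℚ
  norm₁ w j = ∣ seq (re w) j ∣ ⊞ ∣ seq (im w) j ∣

  0≤norm₁ : ∀ w j → 0ℚ ≤ norm₁ w j
  0≤norm₁ w j = ℚP.+-mono-≤ (ℚP.0≤∣p∣ (seq (re w) j)) (ℚP.0≤∣p∣ (seq (im w) j))

  swap : ∀ a b c d → (a ⊞ b) ⊞ (c ⊞ d) ≡ (a ⊞ c) ⊞ (b ⊞ d)
  swap = solve 4 (λ a b c d → (a :+ b) :+ (c :+ d) := (a :+ c) :+ (b :+ d)) refl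
    where open +-*-Solver

  norm₁-+ : ∀ v w j → norm₁ (v + w) j ≤ norm₁ v j ⊞ norm₁ w j
  norm₁-+ v w j = begin
    ∣ a ⊞ c ∣ ⊞ ∣ b ⊞ d ∣                 ≤⟨ ℚP.+-mono-≤ (ℚP.∣p+q∣≤∣p∣+∣q∣ a c) (ℚP.∣p+q∣≤∣p∣+∣q∣ b d) ⟩
    (∣ a ∣ ⊞ ∣ c ∣) ⊞ (∣ b ∣ ⊞ ∣ d ∣)     ≡⟨ swap (∣ a ∣) (∣ c ∣) (∣ b ∣) (∣ d ∣) ⟩
    (∣ a ∣ ⊞ ∣ b ∣) ⊞ (∣ c ∣ ⊞ ∣ d ∣)     ∎
    where
    a = seq (re v) j
    b = seq (im v) j
    c = seq (re w) j
    d = seq (im w) j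

  expand : ∀ a b c d → (a ⊠ c ⊞ b ⊠ d) ⊞ (a ⊠ d ⊞ b ⊠ c) ≡ (a ⊞ b) ⊠ (c ⊞ d)
  expand = solve 4 (λ a b c d → (a :* c :+ b :* d) :+ (a :* d :+ b :* c) :=
                                (a :+ b) :* (c :+ d)) refl
    where open +-*-Solver

  norm₁-* : ∀ v w j → norm₁ (v * w) j ≤ norm₁ v j ⊠ norm₁ w j
  norm₁-* v w j = begin
    ∣ a ⊠ c ⊟ b ⊠ d ∣ ⊞ ∣ a ⊠ d ⊞ b ⊠ c ∣
      ≤⟨ ℚP.+-mono-≤ (ℚP.∣p-q∣≤∣p∣+∣q∣ (a ⊠ c) (b ⊠ d)) (ℚP.∣p+q∣≤∣p∣+∣q∣ (a ⊠ d) (b ⊠ c)) ⟩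
    (∣ a ⊠ c ∣ ⊞ ∣ b ⊠ d ∣) ⊞ (∣ a ⊠ d ∣ ⊞ ∣ b ⊠ c ∣)
      ≡⟨ cong₂ _⊞_ (cong₂ _⊞_ (ℚP.∣p*q∣≡∣p∣*∣q∣ a c) (ℚP.∣p*q∣≡∣p∣*∣q∣ b d))
                   (cong₂ _⊞_ (ℚP.∣p*q∣≡∣p∣*∣q∣ a d) (ℚP.∣p*q∣≡∣p∣*∣q∣ b c)) ⟩
    (∣ a ∣ ⊠ ∣ c ∣ ⊞ ∣ b ∣ ⊠ ∣ d ∣) ⊞ (∣ a ∣ ⊠ ∣ d ∣ ⊞ ∣ b ∣ ⊠ ∣ c ∣)
      ≡⟨ expand (∣ a ∣) (∣ b ∣) (∣ c ∣) (∣ d ∣) ⟩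
    (∣ a ∣ ⊞ ∣ b ∣) ⊠ (∣ c ∣ ⊞ ∣ d ∣) ∎
    where
    a = seq (re v) j
    b = seq (im v) j
    c = seq (re w) j
    d = seq (im w) j

  sumℚ : (ℕ → ℚ) → ℕ → ℚ
  sumℚ u zero    = 0ℚ
  sumℚ u (suc m) = u 0 ⊞ sumℚ (λ k → u (suc k)) m

  norm₁-sum : ∀ (f : ℕ → ℂ) (u : ℕ → ℚ) j → (∀ k → norm₁ (f k) j ≤ u k) →
              ∀ m → norm₁ (partialSum f m) j ≤ sumℚ u m
  norm₁-sum f u j le zero    = ℚP.≤-refl
  norm₁-sum f u j le (suc m) = ℚP.≤-trans
    (norm₁-+ (f 0) (partialSum (λ k → f (suc k)) m) j)
    (ℚP.+-mono-≤ (le 0) (norm₁-sum (λ k → f (suc k)) (λ k → u (suc k)) j (λ k → le (suc k)) m))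

  geometric : ∀ (u : ℕ → ℚ) → (∀ k → 0ℚ ≤ u k) → (∀ k → u (suc k) ≤ ½ ⊠ u k) →
              ∀ m → sumℚ u m ≤ u 0 ⊞ u 0
  geometric u 0≤u h zero    = ℚP.+-mono-≤ (0≤u 0) (0≤u 0)
  geometric u 0≤u h (suc m) = ℚP.+-monoʳ-≤ (u 0) (begin
    sumℚ (λ k → u (suc k)) m ≤⟨ geometric (λ k → u (suc k)) (λ k → 0≤u (suc k)) (λ k → h (suc k)) m ⟩
    u 1 ⊞ u 1                ≤⟨ ℚP.+-mono-≤ (h 0) (h 0) ⟩
    ½ ⊠ u 0 ⊞ ½ ⊠ u 0        ≡⟨ half+half (u 0) ⟩
    u 0 ∎)

  partialSum-ext : ∀ {f h : ℕ → ℂ} → (∀ k → f k ≡ h k) → ∀ m → partialSum f m ≡ partialSum h m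
  partialSum-ext e zero    = refl
  partialSum-ext e (suc m) = cong₂ _+_ (e 0) (partialSum-ext (λ k → e (suc k)) m)

  split : ∀ (g : ℂ → ℚ) → (∀ v w → g (v + w) ≡ g v ⊞ g w) → g 0# ≡ 0ℚ →
          ∀ f n m → g (partialSum f (n ℕ.+ m)) ≡
                    g (partialSum f n) ⊞ g (partialSum (λ k → f (k ℕ.+ n)) m)
  split g g+ g0 f zero m =
    trans (cong g (partialSum-ext (λ k → cong f (sym (ℕP.+-identityʳ k))) m))
      (trans (sym (ℚP.+-identityˡ (g rest))) (cong (_⊞ g rest) (sym g0)))
    where
    rest : ℂ
    rest = partialSum (λ k → f (k ℕ.+ 0)) m
  split g g+ g0 f (suc n) m = trans (g+ (f 0) (partialSum f′ (n ℕ.+ m))) (trans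
    (cong (g (f 0) ⊞_) (trans (split g g+ g0 f′ n m)
      (cong (λ w → g (partialSum f′ n) ⊞ g w)
        (partialSum-ext {λ k → f′ (k ℕ.+ n)} {λ k → f (k ℕ.+ suc n)}
          (λ k → cong f (sym (ℕP.+-suc k n))) m))))
    (trans (sym (ℚP.+-assoc (g (f 0)) (g (partialSum f′ n)) _))
      (cong (_⊞ g (partialSum (λ k → f (k ℕ.+ suc n)) m)) (sym (g+ (f 0) (partialSum f′ n))))))
    where
    f′ : ℕ → ℂ
    f′ k = f (suc k)

  bound₁ : ∃ λ c → Eventually λ j → norm₁ z j ≤ + c / 1
  bound₁ =
    let B , 0<B , N , b = bounded₂ (re z) (im z)
        c , B≤c = large (B ⊞ B)
    in c , N , λ j le → ℚP.≤-trans (ℚP.+-mono-≤ (proj₁ (b j le)) (proj₂ (b j le))) B≤c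

  c : ℕ
  c = proj₁ bound₁

  C : ℚ
  C = + c / 1

  0≤C : 0ℚ ≤ C
  0≤C = /-mono-≤ {+ 0} {+ c} {0} {0} (subst (+ 0 ℤ.≤_) (sym (ℤP.*-identityʳ (+ c))) (ℤ.+≤+ ℕ.z≤n))

  t : ℕ → ℚ
  t zero    = 1ℚ
  t (suc k) = (C ⊠ inv (suc k)) ⊠ t k

  0≤t : ∀ k → 0ℚ ≤ t k
  0≤t zero    = ℚP.nonNegative⁻¹ 1ℚ
  0≤t (suc k) = *-mono-nonNeg ℚP.≤-refl
    (*-mono-nonNeg ℚP.≤-refl 0≤C ℚP.≤-refl (ℚP.<⇒≤ (0<inv (suc k)))) ℚP.≤-refl (0≤t k)

  invFact-suc : ∀ k → invFact (suc k) ≡ inv (suc k) ⊠ invFact k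
  invFact-suc k = inv-* (suc k) (k !) {{_}} {{k ℕP.!≢0}} {{suc k ℕP.!≢0}}

  0<invFact : ∀ k → 0ℚ < invFact k
  0<invFact k = 0<inv (k !) {{k ℕP.!≢0}}

  norm₁-^ : ∀ j → norm₁ z j ≤ C → ∀ k → invFact k ⊠ norm₁ (z ^ k) j ≤ t k
  norm₁-^ j le zero    = ℚP.≤-refl
  norm₁-^ j le (suc k) = begin
    invFact (suc k) ⊠ norm₁ (z ^ suc k) j
      ≡⟨ cong (_⊠ norm₁ (z ^ suc k) j) (invFact-suc k) ⟩
    (inv (suc k) ⊠ invFact k) ⊠ norm₁ (z ^ suc k) j
      ≤⟨ ℚP.*-monoˡ-≤-nonNeg (inv (suc k) ⊠ invFact k) {{nonNegative 0≤p}} (norm₁-* z (z ^ k) j) ⟩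
    (inv (suc k) ⊠ invFact k) ⊠ (norm₁ z j ⊠ norm₁ (z ^ k) j)
      ≡⟨ rearrange (inv (suc k)) (invFact k) (norm₁ z j) (norm₁ (z ^ k) j) ⟩
    (norm₁ z j ⊠ inv (suc k)) ⊠ (invFact k ⊠ norm₁ (z ^ k) j)
      ≤⟨ *-mono-nonNeg
           (*-mono-nonNeg ℚP.≤-refl (0≤norm₁ z j) ℚP.≤-refl 0≤i)
           (*-mono-nonNeg (0≤norm₁ z j) le 0≤i ℚP.≤-refl)
           (*-mono-nonNeg ℚP.≤-refl (ℚP.<⇒≤ (0<invFact k)) ℚP.≤-refl (0≤norm₁ (z ^ k) j))
           (norm₁-^ j le k) ⟩
    (C ⊠ inv (suc k)) ⊠ t k ∎
    where
    0≤i : 0ℚ ≤ inv (suc k)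
    0≤i = ℚP.<⇒≤ (0<inv (suc k))
    0≤p : 0ℚ ≤ inv (suc k) ⊠ invFact k
    0≤p = *-mono-nonNeg ℚP.≤-refl 0≤i ℚP.≤-refl (ℚP.<⇒≤ (0<invFact k))
    rearrange : ∀ a b c d → (a ⊠ b) ⊠ (c ⊠ d) ≡ (c ⊠ a) ⊠ (b ⊠ d)
    rearrange = solve 4 (λ a b c d → (a :* b) :* (c :* d) := (c :* a) :* (b :* d)) refl
      where open +-*-Solver using (solve; _:*_; _:=_)

  norm₁-term : ∀ j → norm₁ z j ≤ C → ∀ k → norm₁ (expTerm z k) j ≤ t k
  norm₁-term j le k = begin
    norm₁ (expTerm z k) j
      ≤⟨ norm₁-* (fromℚᶜ (invFact k)) (z ^ k) j ⟩
    (∣ invFact k ∣ ⊞ 0ℚ) ⊠ norm₁ (z ^ k) j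
      ≡⟨ cong (_⊠ norm₁ (z ^ k) j) (trans (ℚP.+-identityʳ _) (ℚP.0≤p⇒∣p∣≡p (ℚP.<⇒≤ (0<invFact k)))) ⟩
    invFact k ⊠ norm₁ (z ^ k) j
      ≤⟨ norm₁-^ j le k ⟩
    t k ∎

  K₀ : ℕ
  K₀ = 2 ℕ.* c

  t-halves : ∀ k → K₀ ℕ.≤ k → t (suc k) ≤ ½ ⊠ t k
  t-halves k le = ℚP.*-monoʳ-≤-nonNeg (t k) {{nonNegative (0≤t k)}}
    (c*inv≤½ c k (ℕP.≤-trans le (ℕP.n≤1+n k)))

  t-decay : ∀ k → t (k ℕ.+ K₀) ≤ t K₀ ⊠ inv (suc k)
  t-decay zero    = ℚP.≤-reflexive (sym (ℚP.*-identityʳ (t K₀)))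
  t-decay (suc k) = begin
    t (suc (k ℕ.+ K₀))             ≤⟨ t-halves (k ℕ.+ K₀) (ℕP.m≤n+m K₀ k) ⟩
    ½ ⊠ t (k ℕ.+ K₀)               ≤⟨ ℚP.*-monoˡ-≤-nonNeg ½ (t-decay k) ⟩
    ½ ⊠ (t K₀ ⊠ inv (suc k))       ≡⟨ solve 3 (λ a b c → a :* (b :* c) := b :* (a :* c)) refl ½ (t K₀) (inv (suc k)) ⟩
    t K₀ ⊠ (½ ⊠ inv (suc k))       ≤⟨ ℚP.*-monoˡ-≤-nonNeg (t K₀) {{nonNegative (0≤t K₀)}} (½inv k) ⟩
    t K₀ ⊠ inv (suc (suc k)) ∎
    where open +-*-Solver using (solve; _:*_; _:=_)

  t-null : ∀ ε → 0ℚ < ε → ∃ λ N → ∀ n → N ℕ.≤ n → K₀ ℕ.≤ n × t n < ε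
  t-null ε 0<ε = A ℕ.+ K₀ , bnd
    where
    T = t K₀ ⊞ 1ℚ
    0<T : 0ℚ < T
    0<T = ℚP.+-mono-≤-< (0≤t K₀) (ℚP.positive⁻¹ 1ℚ)
    δ : ∃ λ δ → 0ℚ < δ × T ⊠ δ ≡ ε
    δ = shrink 0<T 0<ε
    A = proj₁ (small (proj₁ (proj₂ δ)))
    inv<δ : ∀ k → A ℕ.≤ k → inv (suc k) < proj₁ δ
    inv<δ k le = ℚP.≤-<-trans (inv-anti le) (proj₂ (small (proj₁ (proj₂ δ))))
    at : ∀ k → A ℕ.≤ k → t (k ℕ.+ K₀) < ε
    at k le = begin-strict
      t (k ℕ.+ K₀)       ≤⟨ t-decay k ⟩
      t K₀ ⊠ inv (suc k) ≤⟨ ℚP.*-monoʳ-≤-nonNeg (inv (suc k)) {{nonNegative (ℚP.<⇒≤ (0<inv (suc k)))}}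
                             (subst (_≤ T) (ℚP.+-identityʳ (t K₀)) (ℚP.+-monoʳ-≤ (t K₀) (ℚP.nonNegative⁻¹ 1ℚ))) ⟩
      T ⊠ inv (suc k)    <⟨ ℚP.*-monoʳ-<-pos T {{positive 0<T}} (inv<δ k le) ⟩
      T ⊠ proj₁ δ        ≡⟨ proj₂ (proj₂ δ) ⟩
      ε ∎
    bnd : ∀ n → A ℕ.+ K₀ ℕ.≤ n → K₀ ℕ.≤ n × t n < ε
    bnd n le = ℕP.m+n≤o⇒n≤o A le ,
      subst (λ m → t m < ε) (ℕP.m∸n+n≡m (ℕP.m+n≤o⇒n≤o A le))
        (at (n ℕ.∸ K₀) (ℕP.m+n≤o⇒m≤o∸n A le))

  P : ℕ → ℂ
  P = partialSum (expTerm z)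

  tail : ℕ → ℕ → ℂ
  tail n m = partialSum (λ k → expTerm z (k ℕ.+ n)) m

  norm₁-tail : ∀ j → norm₁ z j ≤ C → ∀ n → K₀ ℕ.≤ n → ∀ m → norm₁ (tail n m) j ≤ t n ⊞ t n
  norm₁-tail j le n K₀≤n m = ℚP.≤-trans
    (norm₁-sum (λ k → expTerm z (k ℕ.+ n)) (λ k → t (k ℕ.+ n)) j (λ k → norm₁-term j le (k ℕ.+ n)) m)
    (geometric (λ k → t (k ℕ.+ n)) (λ k → 0≤t (k ℕ.+ n))
      (λ k → t-halves (k ℕ.+ n) (ℕP.≤-trans K₀≤n (ℕP.m≤n+m n k))) m)

  -- part is re or im.
  part-cauchy : (part : ℂ → ℝ) → (∀ v w j → seq (part (v + w)) j ≡ seq (part v) j ⊞ seq (part w) j) →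
                (∀ j → seq (part 0#) j ≡ 0ℚ) → (∀ w j → ∣ seq (part w) j ∣ ≤ norm₁ w j) →
                IsCauchy (λ n → part (P n))
  part-cauchy part part+ part0 part≤ ε 0<ε = N , bnd
    where
    null = t-null (½ ⊠ ε) (half 0<ε)
    N = proj₁ null
    J = proj₁ (proj₂ bound₁)
    ordered : ∀ j → J ℕ.≤ j → ∀ m n → N ℕ.≤ n → n ℕ.≤ m → ∣ seq (part (P m)) j ⊟ seq (part (P n)) j ∣ < ε
    ordered j J≤j m n N≤n n≤m = begin-strict
      ∣ seq (part (P m)) j ⊟ seq (part (P n)) j ∣
        ≡⟨ cong (λ k → ∣ seq (part (P k)) j ⊟ seq (part (P n)) j ∣) (sym (ℕP.m+[n∸m]≡n n≤m)) ⟩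
      ∣ seq (part (P (n ℕ.+ d))) j ⊟ seq (part (P n)) j ∣
        ≡⟨ cong (λ v → ∣ v ⊟ seq (part (P n)) j ∣)
             (split (λ w → seq (part w) j) (λ v w → part+ v w j) (part0 j) (expTerm z) n d) ⟩
      ∣ (seq (part (P n)) j ⊞ seq (part (tail n d)) j) ⊟ seq (part (P n)) j ∣
        ≡⟨ cong ∣_∣ (solve 2 (λ a b → (a :+ b) :- a := b) refl (seq (part (P n)) j) (seq (part (tail n d)) j)) ⟩
      ∣ seq (part (tail n d)) j ∣
        ≤⟨ part≤ (tail n d) j ⟩
      norm₁ (tail n d) j
        ≤⟨ norm₁-tail j (proj₂ (proj₂ bound₁) j J≤j) n (proj₁ (proj₂ null n N≤n)) d ⟩
      t n ⊞ t n
        <⟨ ℚP.+-mono-< (proj₂ (proj₂ null n N≤n)) (proj₂ (proj₂ null n N≤n)) ⟩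
      ½ ⊠ ε ⊞ ½ ⊠ ε
        ≡⟨ half+half ε ⟩
      ε ∎
      where
      d = m ℕ.∸ n
      open +-*-Solver using (solve; _:+_; _:-_; _:=_)
    either : ∀ j → J ℕ.≤ j → ∀ m n → N ℕ.≤ m → N ℕ.≤ n → ∣ seq (part (P m)) j ⊟ seq (part (P n)) j ∣ < ε
    either j J≤j m n N≤m N≤n = [ ordered j J≤j m n N≤n
      , (λ m≤n → subst (_< ε) (∣-∣-sym (seq (part (P n)) j) (seq (part (P m)) j))
                       (ordered j J≤j n m N≤m m≤n)) ]′ (ℕP.≤-total n m)
    bnd : ∀ m n → N ℕ.≤ m → N ℕ.≤ n → ∣ part (P m) -ᵣ part (P n) ∣ᵣ ≤ᵣ fromℚ ε
    bnd m n N≤m N≤n = mk≤ λ η 0<η → J , λ j J≤j →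
      ℚP.<-trans (either j J≤j m n N≤m N≤n)
        (subst (_< ε ⊞ η) (ℚP.+-identityʳ ε) (ℚP.+-monoʳ-< ε 0<η))

  re-cauchy : IsCauchy (λ n → re (P n))
  re-cauchy = part-cauchy re (λ _ _ _ → refl) (λ _ → refl) λ w j →
    subst (_≤ norm₁ w j) (ℚP.+-identityʳ _) (ℚP.+-monoʳ-≤ ∣ seq (re w) j ∣ (ℚP.0≤∣p∣ (seq (im w) j)))

  im-cauchy : IsCauchy (λ n → im (P n))
  im-cauchy = part-cauchy im (λ _ _ _ → refl) (λ _ → refl) λ w j →
    subst (_≤ norm₁ w j) (ℚP.+-identityˡ _) (ℚP.+-monoˡ-≤ ∣ seq (im w) j ∣ (ℚP.0≤∣p∣ (seq (re w) j)))

  module Re = Limit (λ n → re (P n)) re-cauchy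
  module Im = Limit (λ n → im (P n)) im-cauchy

-- The sum of the exponential series, see exp-sums.
exp : ℂ → ℂ
re (exp z) = ExpConvergence.Re.lim z
im (exp z) = ExpConvergence.Im.lim z

exp-sums : ∀ z → SumsTo (expTerm z) (exp z)
exp-sums z ε 0<ε =
  let N , p = Eventually-× (Re.lim-converges (½ ⊠ ε) (half 0<ε))
                           (Im.lim-converges (½ ⊠ ε) (half 0<ε))
  in N , λ n le → mk≤ λ η 0<η →
     let M , q = Eventually-× (proj₁ (p n le)) (proj₂ (p n le))
     in M , λ j le′ → small-square η 0<η
          (seq (re (P n)) j ⊟ seq Re.lim j) (seq (im (P n)) j ⊟ seq Im.lim j)
          (proj₁ (q j le′)) (proj₂ (q j le′))
  where
  open ExpConvergence z
  open Rat hiding (ℚ; 0ℚ; 1ℚ; ½; _+_; _*_; _-_)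
  open Rat using () renaming (_+_ to _⊞_; _*_ to _⊠_; _-_ to _⊟_)
  open Rational
  open ℚP.≤-Reasoning
  square : ∀ a → a ⊠ a ≡ ∣ a ∣ ⊠ ∣ a ∣
  square a with ℚP.∣p∣≡p∨∣p∣≡-p a
  ... | inj₁ e = sym (cong₂ _⊠_ e e)
  ... | inj₂ e = sym (trans (cong₂ _⊠_ e e) (solve 1 (λ a → (:- a) :* (:- a) := a :* a) refl a))
    where open +-*-Solver
  small-square : ∀ η → 0ℚ < η → ∀ a b → ∣ a ∣ < ½ ⊠ ε → ∣ b ∣ < ½ ⊠ ε →
                 a ⊠ a ⊞ b ⊠ b < ε ⊠ ε ⊞ η
  small-square η 0<η a b a< b< = begin-strict
    a ⊠ a ⊞ b ⊠ b
      ≡⟨ cong₂ _⊞_ (square a) (square b) ⟩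
    ∣ a ∣ ⊠ ∣ a ∣ ⊞ ∣ b ∣ ⊠ ∣ b ∣
      ≤⟨ ℚP.+-mono-≤
           (*-mono-nonNeg (ℚP.0≤∣p∣ a) (ℚP.<⇒≤ a<) (ℚP.0≤∣p∣ a) (ℚP.≤-trans (ℚP.<⇒≤ a<) ½ε≤ε))
           (*-mono-nonNeg (ℚP.0≤∣p∣ b) (ℚP.<⇒≤ b<) (ℚP.0≤∣p∣ b) (ℚP.≤-trans (ℚP.<⇒≤ b<) ½ε≤ε)) ⟩
    (½ ⊠ ε) ⊠ ε ⊞ (½ ⊠ ε) ⊠ ε
      ≡⟨ sym (ℚP.*-distribʳ-+ ε (½ ⊠ ε) (½ ⊠ ε)) ⟩
    (½ ⊠ ε ⊞ ½ ⊠ ε) ⊠ ε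
      ≡⟨ cong (_⊠ ε) (half+half ε) ⟩
    ε ⊠ ε
      ≡⟨ sym (ℚP.+-identityʳ (ε ⊠ ε)) ⟩
    ε ⊠ ε ⊞ 0ℚ
      <⟨ ℚP.+-monoʳ-< (ε ⊠ ε) 0<η ⟩
    ε ⊠ ε ⊞ η ∎
    where
    ½ε≤ε : ½ ⊠ ε ≤ ε
    ½ε≤ε = subst₂ _≤_ (ℚP.+-identityʳ (½ ⊠ ε)) (half+half ε)
             (ℚP.+-monoʳ-≤ (½ ⊠ ε) (ℚP.<⇒≤ (half 0<ε)))

-- 0 = point 0 ≤ tag 0 ≤ point 1 ≤ … ≤ tag (n-1) ≤ point n = 1.
record TaggedPartition (n : ℕ) : Set where
  field
    point : Fin (suc n) → ℝ
    tag   : Fin n → ℝ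
    start : point fzero ≈ᵣ 0ᵣ
    end   : point (fromℕ n) ≈ᵣ 1ᵣ
    left  : ∀ i → point (inject₁ i) ≤ᵣ tag i
    right : ∀ i → tag i ≤ᵣ point (fsuc i)

  MeshAtMost : ℚ → Set
  MeshAtMost δ = ∀ i → point (fsuc i) -ᵣ point (inject₁ i) ≤ᵣ fromℚ δ

open TaggedPartition public using (MeshAtMost)

segment : ℂ → ℂ → ℝ → ℂ
segment a b s = a + fromℝ s * (b - a)

riemannSum : (ℂ → ℂ) → (ℝ → ℂ) → ∀ {n} → TaggedPartition n → ℂ
riemannSum f γ {n} P =
  ∑[ i < n ] (f (γ (tag i)) * (γ (point (fsuc i)) - γ (point (inject₁ i))))
  where open TaggedPartition P

-- I is the Riemann integral of f along the segment from a to b.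
SegmentIntegral : (ℂ → ℂ) → ℂ → ℂ → ℂ → Set
SegmentIntegral f a b I = ∀ ε → 0ℚ Rat.< ε → ∃ λ δ → 0ℚ Rat.< δ ×
  (∀ {n} (P : TaggedPartition n) → MeshAtMost P δ →
   ∥ riemannSum f (segment a b) P - I ∥≤ ε)

fromℕᶜ : ℕ → ℂ
fromℕᶜ n = fromℚᶜ (+ n Rat./ 1)

-- S(m,k), the Stirling numbers of the second kind.
stirling : ℕ → ℕ → ℕ
stirling zero    zero    = 1
stirling zero    (suc k) = 0
stirling (suc m) zero    = 0
stirling (suc m) (suc k) = suc k ℕ.* stirling m (suc k) ℕ.+ stirling m k

φ : ℕ → ℂ → ℂ
φ m x = ∑[ k ≤ m ] (fromℕᶜ (stirling m (toℕ k)) * x ^ toℕ k)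

-- The polynomial φ m t / t, for m ≥ 1; see φ-quotient.
φ/t : ℕ → ℂ → ℂ
φ/t m t = ∑[ k < m ] (fromℕᶜ (stirling m (suc (toℕ k))) * t ^ toℕ k)

φ-quotient : ∀ p t → t * φ/t (suc p) t ≈ φ (suc p) t
φ-quotient p t = R.trans (*-distribˡ-sum t f) (R.trans
  (sum-cong-≋ {suc p} {λ k → t * f k} {λ k → g (fsuc k)} λ k → begin
    t * (c k * t ^ toℕ k) ≈⟨ R.*-assoc t (c k) (t ^ toℕ k) ⟨
    (t * c k) * t ^ toℕ k ≈⟨ R.*-congʳ (R.*-comm t (c k)) ⟩
    (c k * t) * t ^ toℕ k ≈⟨ R.*-assoc (c k) t (t ^ toℕ k) ⟩
    c k * (t * t ^ toℕ k) ∎)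
  (R.sym (R.trans (R.+-congʳ (R.zeroˡ 1#)) (R.+-identityˡ (sum (λ k → g (fsuc k)))))))
  where
  module R = CommutativeRing ℂ-commutativeRing
  open import Algebra.Properties.Semiring.Sum R.semiring using (*-distribˡ-sum; sum-cong-≋)
  open import Relation.Binary.Reasoning.Setoid R.setoid
  c : Fin (suc p) → ℂ
  c k = fromℕᶜ (stirling (suc p) (suc (toℕ k)))
  f : Fin (suc p) → ℂ
  f k = c k * t ^ toℕ k
  g : Fin (suc (suc p)) → ℂ
  g k = fromℕᶜ (stirling (suc p) (toℕ k)) * t ^ toℕ k

-- powerSum p n = 1ᵖ + 2ᵖ + … + nᵖ.
powerSum : ℕ → ℕ → ℕ
powerSum p zero    = 0
powerSum p (suc n) = powerSum p n ℕ.+ suc n ℕ.^ p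

-- The n-th term, n ≥ 1, of the series M(x,p).
MTerm : ℂ → ℕ → ℕ → ℂ
MTerm x p n = fromℕᶜ (powerSum p n) * expTerm x n

{-# OPTIONS --safe #-}
module Submission where

-- The integral is that of a polynomial, so it is enough to bound Riemann sums
-- of tᵏ on [0,1]: squeezing each term between increments of tᵏ⁺¹/(k+1) ± δtᵏ
-- and telescoping shows that a sum of mesh at most δ is within δ of 1/(k+1).
--
-- For the series, mᵖ = ∑ₖ S(p+1,k)(m-1)(m-2)…(m-k+1), the sum being over
-- 1 ≤ k ≤ p+1, and k ∑_{m≤n} (m-1)…(m-k+1) = n(n-1)…(n-k+1). Hence
-- (1ᵖ+…+nᵖ)xⁿ/n! = ∑ₖ S(p+1,k)/k xᵏ · xⁿ⁻ᵏ/(n-k)!, so the series M(x,p) is a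
-- linear combination of delayed copies of the exponential series.

open import Defs
open import Algebra.Bundles using (CommutativeRing)
open import Data.Fin.Base using (Fin; toℕ; inject₁; fromℕ) renaming (zero to fzero; suc to fsuc)
open import Data.Integer.Base as ℤ using (+_; -[1+_])
import Data.Integer.Properties as ℤP
open import Data.Nat.Base as ℕ using (ℕ; zero; suc; _≤_)
import Data.Nat.Properties as ℕP
import Data.Nat.Solver as ℕ-Solver
open import Data.Product.Base using (∃; _×_; _,_; proj₁; proj₂)
open import Data.Rational.Base as ℚ using (ℚ; 0ℚ; 1ℚ; ½; _/_)
import Data.Rational.Properties as ℚP
open import Data.Rational.Solver using (module +-*-Solver)
import Data.Rational.Unnormalised.Base as ℚᵘ
import Data.Rational.Unnormalised.Properties as ℚᵘP
open import Data.Sum.Base using (inj₁; inj₂)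
open import Relation.Binary.PropositionalEquality
  using (_≡_; refl; sym; trans; cong; cong₂; subst; subst₂; module ≡-Reasoning)

module R = CommutativeRing ℝ-commutativeRing
module C = CommutativeRing ℂ-commutativeRing

open import Algebra.Properties.Semiring.Sum R.semiring
  using () renaming (sum to sumᵣ)
open import Algebra.Properties.Semiring.Exp R.semiring
  using () renaming (_^_ to _^ᵣ_; ^-congˡ to ^ᵣ-congˡ)
open import Algebra.Properties.Semiring.Sum C.semiring
  using (sum-cong-≋; ∑-comm; *-distribˡ-sum; *-distribʳ-sum)
open import Algebra.Properties.Semiring.Exp C.semiring using (^-congˡ)
open import Algebra.Properties.CommutativeSemiring.Exp C.commutativeSemiring using (^-distrib-*)
open import Algebra.Properties.Ring C.ring using (x[y-z]≈xy-xz; -0#≈0#)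
import Algebra.Solver.CommutativeMonoid C.*-commutativeMonoid as *-Solver
open import Algebra.Properties.Semiring.Sum ℕP.+-*-semiring
  using () renaming (sum to sumℕ; ∑-distrib-+ to sumℕ-distrib-+; sum-cong-≋ to sumℕ-cong;
                     *-distribˡ-sum to *-distribˡ-sumℕ; sum-replicate-zero to sumℕ-zero)

-- Order on the reals

termwise-≤ᵣ : ∀ {x y} → (∀ n → seq x n ℚ.≤ seq y n) → x ≤ᵣ y
termwise-≤ᵣ {x} {y} le = mk≤ λ ε 0<ε → 0 , λ n _ →
  ℚP.≤-<-trans (le n)
    (subst (ℚ._< seq y n ℚ.+ ε) (ℚP.+-identityʳ (seq y n)) (ℚP.+-monoʳ-< (seq y n) 0<ε))

fromℚ-mono : ∀ {p q} → p ℚ.≤ q → fromℚ p ≤ᵣ fromℚ q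
fromℚ-mono p≤q = termwise-≤ᵣ λ _ → p≤q

p≤∣p∣ : ∀ p → p ℚ.≤ ℚ.∣ p ∣
p≤∣p∣ (ℚ.mkℚ (+ _) _ _)          = ℚP.≤-refl
p≤∣p∣ p@(ℚ.mkℚ -[1+ _ ] _ _) = ℚP.≤-trans (ℚP.nonPositive⁻¹ p) (ℚP.0≤∣p∣ p)

≤ᵣ-reflexive : ∀ {x y} → x ≈ᵣ y → x ≤ᵣ y
≤ᵣ-reflexive {x} {y} p = mk≤ λ ε 0<ε →
  let N , q = close p ε 0<ε
  in N , λ n le → subst (ℚ._< seq y n ℚ.+ ε)
       (solve 2 (λ a b → b :+ (a :- b) := a) refl (seq x n) (seq y n))
       (ℚP.+-monoʳ-< (seq y n) (ℚP.≤-<-trans (p≤∣p∣ (seq x n ℚ.- seq y n)) (q n le)))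
  where open +-*-Solver

≤ᵣ-refl : ∀ {x} → x ≤ᵣ x
≤ᵣ-refl = ≤ᵣ-reflexive R.refl

≤ᵣ-trans : ∀ {x y z} → x ≤ᵣ y → y ≤ᵣ z → x ≤ᵣ z
≤ᵣ-trans {x} {y} {z} p q = mk≤ λ ε 0<ε →
  let N , r = Rational.Eventually-× (below p (½ ℚ.* ε) (Rational.half 0<ε))
                                    (below q (½ ℚ.* ε) (Rational.half 0<ε))
  in N , λ n le → subst (seq x n ℚ.<_)
       (trans (ℚP.+-assoc (seq z n) (½ ℚ.* ε) (½ ℚ.* ε)) (cong (seq z n ℚ.+_) (Rational.half+half ε)))
       (ℚP.<-trans (proj₁ (r n le)) (ℚP.+-monoˡ-< (½ ℚ.* ε) (proj₂ (r n le))))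

≤ᵣ-resp-≈ᵣ : ∀ {x y u v} → x ≈ᵣ y → u ≈ᵣ v → x ≤ᵣ u → y ≤ᵣ v
≤ᵣ-resp-≈ᵣ x≈y u≈v x≤u = ≤ᵣ-trans (≤ᵣ-reflexive (R.sym x≈y)) (≤ᵣ-trans x≤u (≤ᵣ-reflexive u≈v))

+ᵣ-mono-≤ᵣ : ∀ {x y u v} → x ≤ᵣ y → u ≤ᵣ v → x +ᵣ u ≤ᵣ y +ᵣ v
+ᵣ-mono-≤ᵣ {x} {y} {u} {v} p q = mk≤ λ ε 0<ε →
  let N , r = Rational.Eventually-× (below p (½ ℚ.* ε) (Rational.half 0<ε))
                                    (below q (½ ℚ.* ε) (Rational.half 0<ε))
  in N , λ n le → subst (seq x n ℚ.+ seq u n ℚ.<_)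
       (trans
         (solve 3 (λ y v h → (y :+ h) :+ (v :+ h) := (y :+ v) :+ (h :+ h)) refl (seq y n) (seq v n) (½ ℚ.* ε))
         (cong (seq y n ℚ.+ seq v n ℚ.+_) (Rational.half+half ε)))
       (ℚP.+-mono-< (proj₁ (r n le)) (proj₂ (r n le)))
  where open +-*-Solver

x≤y⇒0≤y-x : ∀ {x y} → x ≤ᵣ y → 0ᵣ ≤ᵣ y -ᵣ x
x≤y⇒0≤y-x {x} p = ≤ᵣ-resp-≈ᵣ (R.-‿inverseʳ x) R.refl (+ᵣ-mono-≤ᵣ p ≤ᵣ-refl)

-- Reduces an inequality to the nonnegativity of a difference, which a ring identity checked
-- termwise can then bring into a convenient form.
0≤y-x⇒x≤y : ∀ {x y} → 0ᵣ ≤ᵣ y -ᵣ x → x ≤ᵣ y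
0≤y-x⇒x≤y {x} {y} p = ≤ᵣ-resp-≈ᵣ (R.+-identityˡ x)
  (termwise λ n → solve 2 (λ a b → (b :- a) :+ a := b) refl (seq x n) (seq y n))
  (+ᵣ-mono-≤ᵣ p ≤ᵣ-refl)
  where open +-*-Solver

-ᵣ-mono-≤ᵣ : ∀ {x y u v} → x ≤ᵣ y → v ≤ᵣ u → x -ᵣ u ≤ᵣ y -ᵣ v
-ᵣ-mono-≤ᵣ {x} {y} {u} {v} p q = 0≤y-x⇒x≤y (≤ᵣ-resp-≈ᵣ (R.+-identityˡ 0ᵣ)
  (termwise λ n → solve 4 (λ x y u v → (y :- x) :+ (u :- v) := (y :- v) :- (x :- u)) refl
    (seq x n) (seq y n) (seq u n) (seq v n))
  (+ᵣ-mono-≤ᵣ (x≤y⇒0≤y-x p) (x≤y⇒0≤y-x q)))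
  where open +-*-Solver

-- `0ᵣ ≤ᵣ x` still allows slightly negative terms; this supplies a representative whose terms are
-- all nonnegative. A term a above -ε/2 either equals its absolute value or is negative and differs
-- from it by at most 2∣a∣ < ε.
0≤x⇒x≈∣x∣ : ∀ {x} → 0ᵣ ≤ᵣ x → x ≈ᵣ ∣ x ∣ᵣ
0≤x⇒x≈∣x∣ {x} p = mk≈ λ ε 0<ε →
  let N , q = below p (½ ℚ.* ε) (Rational.half 0<ε)
  in N , λ n le → bound ε 0<ε (seq x n) (q n le)
  where
  bound : ∀ ε → 0ℚ ℚ.< ε → ∀ a → 0ℚ ℚ.< a ℚ.+ ½ ℚ.* ε → ℚ.∣ a ℚ.- ℚ.∣ a ∣ ∣ ℚ.< ε
  bound ε 0<ε a 0<a+½ε with ℚP.∣p∣≡p∨∣p∣≡-p a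
  ... | inj₁ e = subst (ℚ._< ε)
    (sym (trans (cong (λ b → ℚ.∣ a ℚ.- b ∣) e) (Rational.∣a-a∣ a))) 0<ε
  ... | inj₂ e = begin-strict
    ℚ.∣ a ℚ.- ℚ.∣ a ∣ ∣        ≤⟨ ℚP.∣p-q∣≤∣p∣+∣q∣ a ℚ.∣ a ∣ ⟩
    ℚ.∣ a ∣ ℚ.+ ℚ.∣ ℚ.∣ a ∣ ∣  ≡⟨ cong (ℚ.∣ a ∣ ℚ.+_) (ℚP.∣∣p∣∣≡∣p∣ a) ⟩
    ℚ.∣ a ∣ ℚ.+ ℚ.∣ a ∣        <⟨ ℚP.+-mono-< ∣a∣<½ε ∣a∣<½ε ⟩
    ½ ℚ.* ε ℚ.+ ½ ℚ.* ε        ≡⟨ Rational.half+half ε ⟩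
    ε                          ∎
    where
    open ℚP.≤-Reasoning
    open +-*-Solver
    ∣a∣<½ε : ℚ.∣ a ∣ ℚ.< ½ ℚ.* ε
    ∣a∣<½ε = subst₂ ℚ._<_ (trans (ℚP.+-identityʳ (ℚ.- a)) (sym e))
      (solve 2 (λ a b → (:- a) :+ (a :+ b) := b) refl a (½ ℚ.* ε))
      (ℚP.+-monoʳ-< (ℚ.- a) 0<a+½ε)

-- Once both factors are replaced by their absolute values, the product is nonnegative term by term.
*ᵣ-nonNeg : ∀ {x y} → 0ᵣ ≤ᵣ x → 0ᵣ ≤ᵣ y → 0ᵣ ≤ᵣ x *ᵣ y
*ᵣ-nonNeg {x} {y} p q = ≤ᵣ-resp-≈ᵣ R.refl
  (R.*-cong (R.sym (0≤x⇒x≈∣x∣ p)) (R.sym (0≤x⇒x≈∣x∣ q)))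
  (termwise-≤ᵣ λ n → Rational.*-mono-nonNeg ℚP.≤-refl (ℚP.0≤∣p∣ (seq x n)) ℚP.≤-refl (ℚP.0≤∣p∣ (seq y n)))

*ᵣ-monoˡ-≤ᵣ : ∀ {c x y} → 0ᵣ ≤ᵣ c → x ≤ᵣ y → c *ᵣ x ≤ᵣ c *ᵣ y
*ᵣ-monoˡ-≤ᵣ {c} {x} {y} 0≤c x≤y = 0≤y-x⇒x≤y (≤ᵣ-resp-≈ᵣ R.refl
  (termwise λ n → solve 3 (λ c x y → c :* (y :- x) := c :* y :- c :* x) refl (seq c n) (seq x n) (seq y n))
  (*ᵣ-nonNeg 0≤c (x≤y⇒0≤y-x x≤y)))
  where open +-*-Solver

*ᵣ-monoʳ-≤ᵣ : ∀ {c x y} → 0ᵣ ≤ᵣ c → x ≤ᵣ y → x *ᵣ c ≤ᵣ y *ᵣ c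
*ᵣ-monoʳ-≤ᵣ {c} {x} {y} 0≤c x≤y =
  ≤ᵣ-resp-≈ᵣ (R.*-comm c x) (R.*-comm c y) (*ᵣ-monoˡ-≤ᵣ 0≤c x≤y)

^ᵣ-nonNeg : ∀ {x} → 0ᵣ ≤ᵣ x → ∀ k → 0ᵣ ≤ᵣ x ^ᵣ k
^ᵣ-nonNeg 0≤x zero    = fromℚ-mono (ℚP.nonNegative⁻¹ 1ℚ)
^ᵣ-nonNeg 0≤x (suc k) = *ᵣ-nonNeg 0≤x (^ᵣ-nonNeg 0≤x k)

^ᵣ-monoˡ-≤ᵣ : ∀ {x y} → 0ᵣ ≤ᵣ x → x ≤ᵣ y → ∀ k → x ^ᵣ k ≤ᵣ y ^ᵣ k
^ᵣ-monoˡ-≤ᵣ 0≤x x≤y zero    = ≤ᵣ-refl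
^ᵣ-monoˡ-≤ᵣ 0≤x x≤y (suc k) = ≤ᵣ-trans
  (*ᵣ-monoʳ-≤ᵣ (^ᵣ-nonNeg 0≤x k) x≤y)
  (*ᵣ-monoˡ-≤ᵣ (≤ᵣ-trans 0≤x x≤y) (^ᵣ-monoˡ-≤ᵣ 0≤x x≤y k))

-- δ² - r² = (δ - r)(r + δ), a product of nonnegative factors.
square-≤ᵣ : ∀ {r δ} → -ᵣ δ ≤ᵣ r → r ≤ᵣ δ → r *ᵣ r ≤ᵣ δ *ᵣ δ
square-≤ᵣ {r} {δ} p q = 0≤y-x⇒x≤y (≤ᵣ-resp-≈ᵣ R.refl
  (termwise λ n → solve 2 (λ r δ → (δ :- r) :* (r :- :- δ) := δ :* δ :- r :* r) refl (seq r n) (seq δ n))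
  (*ᵣ-nonNeg (x≤y⇒0≤y-x q) (x≤y⇒0≤y-x p)))
  where open +-*-Solver

-- Complex norms

normSq-cong : ∀ {z w} → z ≈ w → normSq z ≈ᵣ normSq w
normSq-cong (a ,ᶜ b) = R.+-cong (R.*-cong a a) (R.*-cong b b)

-- The two-square identity of Brahmagupta and Fibonacci, applied to each term.
normSq-* : ∀ z w → normSq (z * w) ≈ᵣ normSq z *ᵣ normSq w
normSq-* z w = termwise λ n →
  solve 4 (λ a b c d → (a :* c :- b :* d) :* (a :* c :- b :* d) :+ (a :* d :+ b :* c) :* (a :* d :+ b :* c)
                    := (a :* a :+ b :* b) :* (c :* c :+ d :* d))
    refl (seq (re z) n) (seq (im z) n) (seq (re w) n) (seq (im w) n)
  where open +-*-Solver

0≤square : ∀ a → 0ℚ ℚ.≤ a ℚ.* a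
0≤square a with ℚP.≤-total 0ℚ a
... | inj₁ 0≤a = Rational.*-mono-nonNeg ℚP.≤-refl 0≤a ℚP.≤-refl 0≤a
... | inj₂ a≤0 = subst (0ℚ ℚ.≤_)
  (solve 1 (λ a → (:- a) :* (:- a) := a :* a) refl a)
  (Rational.*-mono-nonNeg ℚP.≤-refl (ℚP.neg-antimono-≤ a≤0) ℚP.≤-refl (ℚP.neg-antimono-≤ a≤0))
  where open +-*-Solver

0≤normSq : ∀ z → 0ᵣ ≤ᵣ normSq z
0≤normSq z = termwise-≤ᵣ λ n → ℚP.+-mono-≤ (0≤square (seq (re z) n)) (0≤square (seq (im z) n))

-- By the parallelogram law the difference of the two sides is `normSq (z - w)`. This replaces the
-- triangle inequality, which would need square roots.
normSq-+ : ∀ z w → normSq (z + w) ≤ᵣ (normSq z +ᵣ normSq z) +ᵣ (normSq w +ᵣ normSq w)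
normSq-+ z w = 0≤y-x⇒x≤y (≤ᵣ-resp-≈ᵣ R.refl parallelogram (0≤normSq (z - w)))
  where
  open +-*-Solver
  parallelogram : normSq (z - w) ≈ᵣ ((normSq z +ᵣ normSq z) +ᵣ (normSq w +ᵣ normSq w)) -ᵣ normSq (z + w)
  parallelogram = termwise λ n →
    solve 4 (λ a b c d →
      (a :- c) :* (a :- c) :+ (b :- d) :* (b :- d) :=
      (((a :* a :+ b :* b) :+ (a :* a :+ b :* b)) :+ ((c :* c :+ d :* d) :+ (c :* c :+ d :* d)))
        :- ((a :+ c) :* (a :+ c) :+ (b :+ d) :* (b :+ d)))
      refl (seq (re z) n) (seq (im z) n) (seq (re w) n) (seq (im w) n)

∥∥-cong : ∀ {z w} ε → z ≈ w → ∥ z ∥≤ ε → ∥ w ∥≤ ε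
∥∥-cong ε z≈w = ≤ᵣ-resp-≈ᵣ (normSq-cong z≈w) R.refl

-- The factor 2 lost in `normSq-+` is harmless: the bound becomes 4(ε/2)² = ε².
∥∥-+ : ∀ z w ε → ∥ z ∥≤ (½ ℚ.* ε) → ∥ w ∥≤ (½ ℚ.* ε) → ∥ z + w ∥≤ ε
∥∥-+ z w ε p q = ≤ᵣ-trans (normSq-+ z w)
  (≤ᵣ-resp-≈ᵣ R.refl (termwise λ _ → four-halves)
    (+ᵣ-mono-≤ᵣ (+ᵣ-mono-≤ᵣ p p) (+ᵣ-mono-≤ᵣ q q)))
  where
  h = ½ ℚ.* ε
  four-halves : ((h ℚ.* h) ℚ.+ (h ℚ.* h)) ℚ.+ ((h ℚ.* h) ℚ.+ (h ℚ.* h)) ≡ ε ℚ.* ε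
  four-halves = trans
    (solve 1 (λ h → ((h :* h) :+ (h :* h)) :+ ((h :* h) :+ (h :* h)) := (h :+ h) :* (h :+ h)) refl h)
    (cong₂ ℚ._*_ (Rational.half+half ε) (Rational.half+half ε))
    where open +-*-Solver

∥0∥ : ∀ ε → ∥ 0# ∥≤ ε
∥0∥ ε = termwise-≤ᵣ λ _ → 0≤square ε

-- A bound A on ∣c∣² gives the bound A + 1 on ∣c∣, because A ≤ (A + 1)²; no root of A is taken.
normSq-bounded : ∀ c → ∃ λ B → 0ℚ ℚ.< B × ∥ c ∥≤ B
normSq-bounded c =
  let A , 0<A , N , b = bounded (normSq c)
      B = A ℚ.+ 1ℚ
      0≤A = ℚP.<⇒≤ 0<A
  in B , Rational.0<+ 0<A (ℚP.positive⁻¹ 1ℚ) , mk≤ λ ε 0<ε → N , λ n le →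
     let open ℚP.≤-Reasoning in begin-strict
     seq (normSq c) n                ≤⟨ p≤∣p∣ _ ⟩
     ℚ.∣ seq (normSq c) n ∣          ≤⟨ b n le ⟩
     A                               ≡⟨ ℚP.+-identityʳ A ⟨
     A ℚ.+ 0ℚ                        ≤⟨ ℚP.+-monoʳ-≤ A (ℚP.+-mono-≤ (ℚP.+-mono-≤ 0≤A (0≤square A)) (ℚP.nonNegative⁻¹ 1ℚ)) ⟩
     A ℚ.+ ((A ℚ.+ A ℚ.* A) ℚ.+ 1ℚ)  ≡⟨ binomial A ⟩
     B ℚ.* B                         ≡⟨ ℚP.+-identityʳ (B ℚ.* B) ⟨
     B ℚ.* B ℚ.+ 0ℚ                  <⟨ ℚP.+-monoʳ-< (B ℚ.* B) 0<ε ⟩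
     B ℚ.* B ℚ.+ ε                   ∎
  where
  binomial : ∀ A → A ℚ.+ ((A ℚ.+ A ℚ.* A) ℚ.+ 1ℚ) ≡ (A ℚ.+ 1ℚ) ℚ.* (A ℚ.+ 1ℚ)
  binomial = solve 1 (λ A → A :+ ((A :+ A :* A) :+ con 1ℚ) := (A :+ con 1ℚ) :* (A :+ con 1ℚ)) refl
    where open +-*-Solver

∥∥-* : ∀ c z {B} δ {ε} → ∥ c ∥≤ B → B ℚ.* δ ≡ ε → ∥ z ∥≤ δ → ∥ c * z ∥≤ ε
∥∥-* c z {B} δ p refl q = ≤ᵣ-resp-≈ᵣ (R.sym (normSq-* c z))
  (termwise λ _ → solve 2 (λ B δ → (B :* B) :* (δ :* δ) := (B :* δ) :* (B :* δ)) refl B δ)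
  (≤ᵣ-trans (*ᵣ-monoˡ-≤ᵣ (0≤normSq c) q) (*ᵣ-monoʳ-≤ᵣ (fromℚ-mono (0≤square δ)) p))
  where open +-*-Solver

-- Limits

-- Partial sums along ℕ and Riemann sums along partitions of vanishing mesh
-- converge along filter bases, so they share their limit laws.
record FilterBase (A : Set) : Set₁ where
  field
    Stage   : Set
    _∈_     : A → Stage → Set
    _∩_     : Stage → Stage → Stage
    ∩-left  : ∀ {a s t} → a ∈ (s ∩ t) → a ∈ s
    ∩-right : ∀ {a s t} → a ∈ (s ∩ t) → a ∈ t
    all     : Stage

module Limits {A : Set} (F : FilterBase A) where
  open FilterBase F

  -- For `atInfinity` and partial sums, `stage` is literally `SumsTo`; for `finePartitions` and
  -- Riemann sums it is `SegmentIntegral` up to currying.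
  record Tends (u : A → ℂ) (l : ℂ) : Set where
    constructor tends
    field
      stage : ∀ ε → 0ℚ ℚ.< ε → ∃ λ s → ∀ a → a ∈ s → ∥ u a - l ∥≤ ε

  open Tends public

  Tends-cong : ∀ {u v k l} → (∀ a → u a ≈ v a) → k ≈ l → Tends u k → Tends v l
  Tends-cong u≈v k≈l p = tends λ ε 0<ε →
    let s , q = stage p ε 0<ε
    in s , λ a a∈s → ∥∥-cong ε (C.+-cong (u≈v a) (C.-‿cong k≈l)) (q a a∈s)

  Tends-0 : Tends (λ _ → 0#) 0#
  Tends-0 = tends λ ε 0<ε → all , λ _ _ → ∥∥-cong ε (C.sym (C.-‿inverseʳ 0#)) (∥0∥ ε)

  Tends-+ : ∀ {u v k l} → Tends u k → Tends v l → Tends (λ a → u a + v a) (k + l)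
  Tends-+ {u} {v} {k} {l} p q = tends λ ε 0<ε →
    let s , p′ = stage p (½ ℚ.* ε) (Rational.half 0<ε)
        t , q′ = stage q (½ ℚ.* ε) (Rational.half 0<ε)
    in s ∩ t , λ a a∈ → ∥∥-cong ε (interchange (u a) (v a))
         (∥∥-+ (u a - k) (v a - l) ε (p′ a (∩-left a∈)) (q′ a (∩-right a∈)))
    where
    open +-*-Solver
    diff : ∀ a b c d → (a ℚ.- c) ℚ.+ (b ℚ.- d) ≡ (a ℚ.+ b) ℚ.- (c ℚ.+ d)
    diff = solve 4 (λ a b c d → (a :- c) :+ (b :- d) := (a :+ b) :- (c :+ d)) refl
    interchange : ∀ z w → (z - k) + (w - l) ≈ (z + w) - (k + l)
    interchange z w =
      termwise (λ n → diff (seq (re z) n) (seq (re w) n) (seq (re k) n) (seq (re l) n)) ,ᶜ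
      termwise (λ n → diff (seq (im z) n) (seq (im w) n) (seq (im k) n) (seq (im l) n))

  Tends-*ˡ : ∀ c {u l} → Tends u l → Tends (λ a → c * u a) (c * l)
  Tends-*ˡ c {u} {l} p = tends λ ε 0<ε →
    let B , 0<B , b = normSq-bounded c
        δ , 0<δ , Bδ≡ε = Rational.shrink 0<B 0<ε
        s , q = stage p δ 0<δ
    in s , λ a a∈s → ∥∥-cong ε (x[y-z]≈xy-xz c (u a) l) (∥∥-* c (u a - l) {B} δ b Bδ≡ε (q a a∈s))

  Tends-sum : ∀ {n} {u : Fin n → A → ℂ} {l : Fin n → ℂ} → (∀ i → Tends (u i) (l i)) →
              Tends (λ a → sum λ i → u i a) (sum l)
  Tends-sum {zero}  p = Tends-0
  Tends-sum {suc n} p = Tends-+ (p fzero) (Tends-sum λ i → p (fsuc i))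

atInfinity : FilterBase ℕ
atInfinity = record
  { Stage = ℕ ; _∈_ = λ n N → N ≤ n ; _∩_ = ℕ._⊔_
  ; ∩-left  = λ {_} {M} {N} → ℕP.m⊔n≤o⇒m≤o M N
  ; ∩-right = λ {_} {M} {N} → ℕP.m⊔n≤o⇒n≤o M N
  ; all = 0
  }

finePartitions : FilterBase (∃ TaggedPartition)
finePartitions = record
  { Stage = ∃ λ δ → 0ℚ ℚ.< δ
  ; _∈_ = λ (_ , P) (δ , _) → MeshAtMost P δ
  ; _∩_ = λ (γ , 0<γ) (δ , 0<δ) → γ ℚ.⊓ δ , ⊓-pos 0<γ 0<δ
  ; ∩-left  = λ {_} {(γ , _)} {(δ , _)} m i → ≤ᵣ-trans (m i) (fromℚ-mono (ℚP.p⊓q≤p γ δ))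
  ; ∩-right = λ {_} {(γ , _)} {(δ , _)} m i → ≤ᵣ-trans (m i) (fromℚ-mono (ℚP.p⊓q≤q γ δ))
  -- Despite its name, `all` only has to be some stage, so any positive mesh bound serves.
  ; all = 1ℚ , ℚP.positive⁻¹ 1ℚ
  }
  where
  ⊓-pos : ∀ {γ δ} → 0ℚ ℚ.< γ → 0ℚ ℚ.< δ → 0ℚ ℚ.< γ ℚ.⊓ δ
  ⊓-pos {γ} {δ} 0<γ 0<δ with ℚP.⊓-sel γ δ
  ... | inj₁ e = subst (0ℚ ℚ.<_) (sym e) 0<γ
  ... | inj₂ e = subst (0ℚ ℚ.<_) (sym e) 0<δ

-- Natural numbers in ℚ

ℕ/1-+ : ∀ m n → + (m ℕ.+ n) / 1 ≡ + m / 1 ℚ.+ + n / 1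
ℕ/1-+ m n = ℚP.toℚᵘ-injective
  (ℚᵘP.≃-trans (Rational.toℚᵘ-/ (+ (m ℕ.+ n)) 0) (ℚᵘP.≃-sym
    (ℚᵘP.≃-trans (ℚP.toℚᵘ-homo-+ (+ m / 1) (+ n / 1)) (ℚᵘP.≃-trans
      (ℚᵘP.+-cong (Rational.toℚᵘ-/ (+ m) 0) (Rational.toℚᵘ-/ (+ n) 0))
      (ℚᵘ.*≡* (cong (ℤ._* + 1) (cong₂ ℤ._+_ (ℤP.*-identityʳ (+ m)) (ℤP.*-identityʳ (+ n)))))))))

ℕ/1-* : ∀ m n → + (m ℕ.* n) / 1 ≡ (+ m / 1) ℚ.* (+ n / 1)
ℕ/1-* m n = ℚP.toℚᵘ-injective
  (ℚᵘP.≃-trans (Rational.toℚᵘ-/ (+ (m ℕ.* n)) 0) (ℚᵘP.≃-sym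
    (ℚᵘP.≃-trans (ℚP.toℚᵘ-homo-* (+ m / 1) (+ n / 1)) (ℚᵘP.≃-trans
      (ℚᵘP.*-cong (Rational.toℚᵘ-/ (+ m) 0) (Rational.toℚᵘ-/ (+ n) 0))
      (ℚᵘ.*≡* (cong (ℤ._* + 1) (sym (ℤP.pos-* m n))))))))

1/n*n≡1 : ∀ k → (+ 1 / suc k) ℚ.* (+ suc k / 1) ≡ 1ℚ
1/n*n≡1 k = ℚP.toℚᵘ-injective
  (ℚᵘP.≃-trans (ℚP.toℚᵘ-homo-* (+ 1 / suc k) (+ suc k / 1)) (ℚᵘP.≃-trans
    (ℚᵘP.*-cong (Rational.toℚᵘ-/ (+ 1) k) (Rational.toℚᵘ-/ (+ suc k) 0))
    (ℚᵘ.*≡* (trans (ℤP.*-identityʳ (+ 1 ℤ.* + suc k))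
      (cong (λ n → + 1 ℤ.* + n) (sym (ℕP.*-identityʳ (suc k))))))))

-- Riemann sums of powers over [0,1]

module PowerIncrement {s t : ℝ} (0≤s : 0ᵣ ≤ᵣ s) (s≤t : s ≤ᵣ t) where
  private
    0≤t : 0ᵣ ≤ᵣ t
    0≤t = ≤ᵣ-trans 0≤s s≤t

    0≤Δ : 0ᵣ ≤ᵣ t -ᵣ s
    0≤Δ = x≤y⇒0≤y-x s≤t

    [_] : ℕ → ℝ
    [ n ] = fromℚ (+ n / 1)

    D : ℕ → ℝ
    D k = t ^ᵣ suc k -ᵣ s ^ᵣ suc k

    0≤D : ∀ k → 0ᵣ ≤ᵣ D k
    0≤D k = x≤y⇒0≤y-x (^ᵣ-monoˡ-≤ᵣ 0≤s s≤t (suc k))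

    D-zero : D 0 ≈ᵣ [ 1 ] *ᵣ (1ᵣ *ᵣ (t -ᵣ s))
    D-zero = termwise λ n →
      solve 2 (λ s t → t :* con 1ℚ :- s :* con 1ℚ := con 1ℚ :* (con 1ℚ :* (t :- s))) refl (seq s n) (seq t n)
      where open +-*-Solver

    -- Drives both inductions below, which replace the mean value theorem: tD and the correction
    -- sᵏ⁺¹(t - s) are estimated separately, using s ≤ t.
    D-suc : ∀ k → t *ᵣ D k +ᵣ s ^ᵣ suc k *ᵣ (t -ᵣ s) ≈ᵣ D (suc k)
    D-suc k = termwise λ n →
      solve 4 (λ s t u v → t :* (t :* v :- s :* u) :+ (s :* u) :* (t :- s) := t :* (t :* v) :- s :* (s :* u)) refl
        (seq s n) (seq t n) (seq (s ^ᵣ k) n) (seq (t ^ᵣ k) n)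
      where open +-*-Solver

    multiple-suc : ∀ u k → u *ᵣ ([ suc k ] *ᵣ (u ^ᵣ k *ᵣ (t -ᵣ s))) +ᵣ u ^ᵣ suc k *ᵣ (t -ᵣ s)
                         ≈ᵣ [ suc (suc k) ] *ᵣ (u ^ᵣ suc k *ᵣ (t -ᵣ s))
    multiple-suc u k = termwise λ n → trans
      (solve 4 (λ c u v d → u :* (c :* (v :* d)) :+ (u :* v) :* d := (con 1ℚ :+ c) :* ((u :* v) :* d)) refl
        (+ suc k / 1) (seq u n) (seq (u ^ᵣ k) n) (seq (t -ᵣ s) n))
      (cong (ℚ._* (seq (u ^ᵣ suc k) n ℚ.* seq (t -ᵣ s) n)) (sym (ℕ/1-+ 1 (suc k))))
      where open +-*-Solver

    lower : ∀ k → [ suc k ] *ᵣ (s ^ᵣ k *ᵣ (t -ᵣ s)) ≤ᵣ D k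
    lower zero    = ≤ᵣ-reflexive (R.sym D-zero)
    lower (suc k) = ≤ᵣ-resp-≈ᵣ (multiple-suc s k) (D-suc k)
      (+ᵣ-mono-≤ᵣ
        (≤ᵣ-trans (*ᵣ-monoˡ-≤ᵣ 0≤s (lower k)) (*ᵣ-monoʳ-≤ᵣ (0≤D k) s≤t))
        ≤ᵣ-refl)

    upper : ∀ k → D k ≤ᵣ [ suc k ] *ᵣ (t ^ᵣ k *ᵣ (t -ᵣ s))
    upper zero    = ≤ᵣ-reflexive D-zero
    upper (suc k) = ≤ᵣ-resp-≈ᵣ (D-suc k) (multiple-suc t k)
      (+ᵣ-mono-≤ᵣ
        (*ᵣ-monoˡ-≤ᵣ 0≤t (upper k))
        (*ᵣ-monoʳ-≤ᵣ 0≤Δ (^ᵣ-monoˡ-≤ᵣ 0≤s s≤t (suc k))))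

    divide : ∀ k y → fromℚ (+ 1 / suc k) *ᵣ ([ suc k ] *ᵣ y) ≈ᵣ y
    divide k y = termwise λ n → trans
      (sym (ℚP.*-assoc (+ 1 / suc k) (+ suc k / 1) (seq y n)))
      (trans (cong (ℚ._* seq y n) (1/n*n≡1 k)) (ℚP.*-identityˡ (seq y n)))

    0≤1/ : ∀ k → 0ᵣ ≤ᵣ fromℚ (+ 1 / suc k)
    0≤1/ k = fromℚ-mono (ℚP.<⇒≤ (Rational.0<inv (suc k)))

  increment-lower : ∀ k → s ^ᵣ k *ᵣ (t -ᵣ s) ≤ᵣ fromℚ (+ 1 / suc k) *ᵣ (t ^ᵣ suc k -ᵣ s ^ᵣ suc k)
  increment-lower k = ≤ᵣ-resp-≈ᵣ (divide k _) R.refl (*ᵣ-monoˡ-≤ᵣ (0≤1/ k) (lower k))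

  increment-upper : ∀ k → fromℚ (+ 1 / suc k) *ᵣ (t ^ᵣ suc k -ᵣ s ^ᵣ suc k) ≤ᵣ t ^ᵣ k *ᵣ (t -ᵣ s)
  increment-upper k = ≤ᵣ-resp-≈ᵣ R.refl (divide k _) (*ᵣ-monoˡ-≤ᵣ (0≤1/ k) (upper k))

antiderivative : ℕ → ℚ → ℝ → ℝ
antiderivative k δ t = fromℚ (+ 1 / suc k) *ᵣ t ^ᵣ suc k +ᵣ fromℚ δ *ᵣ t ^ᵣ k

-- When t - s ≤ δ, the term τᵏ(t - s) of a Riemann sum lies between the
-- increments of tᵏ⁺¹/(k+1) - δtᵏ and tᵏ⁺¹/(k+1) + δtᵏ, and these telescope.
module _ {s τ t : ℝ} {δ : ℚ} (0≤s : 0ᵣ ≤ᵣ s) (s≤τ : s ≤ᵣ τ) (τ≤t : τ ≤ᵣ t) (mesh : t -ᵣ s ≤ᵣ fromℚ δ)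
         (k : ℕ) where
  private
    s≤t : s ≤ᵣ t
    s≤t = ≤ᵣ-trans s≤τ τ≤t

    open PowerIncrement 0≤s s≤t

    0≤τ : 0ᵣ ≤ᵣ τ
    0≤τ = ≤ᵣ-trans 0≤s s≤τ

    0≤Δ : 0ᵣ ≤ᵣ t -ᵣ s
    0≤Δ = x≤y⇒0≤y-x s≤t

    spread : (t ^ᵣ k -ᵣ s ^ᵣ k) *ᵣ (t -ᵣ s) ≤ᵣ (t ^ᵣ k -ᵣ s ^ᵣ k) *ᵣ fromℚ δ
    spread = *ᵣ-monoˡ-≤ᵣ (x≤y⇒0≤y-x (^ᵣ-monoˡ-≤ᵣ 0≤s s≤t k)) mesh

    open +-*-Solver

  -- With Δ = t - s, τᵏΔ ≤ tᵏΔ = sᵏΔ + (tᵏ - sᵏ)Δ. The first summand is bounded by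
  -- `increment-lower`, the second by `spread`.
  term-upper : τ ^ᵣ k *ᵣ (t -ᵣ s) ≤ᵣ antiderivative k δ t -ᵣ antiderivative k δ s
  term-upper = ≤ᵣ-trans (*ᵣ-monoʳ-≤ᵣ 0≤Δ (^ᵣ-monoˡ-≤ᵣ 0≤τ τ≤t k))
    (≤ᵣ-resp-≈ᵣ
      (termwise λ n → solve 3 (λ u v d → u :* d :+ (v :- u) :* d := v :* d) refl
        (seq (s ^ᵣ k) n) (seq (t ^ᵣ k) n) (seq (t -ᵣ s) n))
      (termwise λ n → solve 6 (λ c δ u v u′ v′ →
          c :* (v′ :- u′) :+ (v :- u) :* δ := (c :* v′ :+ δ :* v) :- (c :* u′ :+ δ :* u)) refl
        (+ 1 / suc k) δ (seq (s ^ᵣ k) n) (seq (t ^ᵣ k) n) (seq (s ^ᵣ suc k) n) (seq (t ^ᵣ suc k) n))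
      (+ᵣ-mono-≤ᵣ (increment-lower k) spread))

  -- The mirror image: τᵏΔ ≥ sᵏΔ = tᵏΔ - (tᵏ - sᵏ)Δ, now with `increment-upper`.
  term-lower : antiderivative k (ℚ.- δ) t -ᵣ antiderivative k (ℚ.- δ) s ≤ᵣ τ ^ᵣ k *ᵣ (t -ᵣ s)
  term-lower = ≤ᵣ-trans
    (≤ᵣ-resp-≈ᵣ
      (termwise λ n → solve 6 (λ c δ u v u′ v′ →
          c :* (v′ :- u′) :- (v :- u) :* δ := (c :* v′ :+ (:- δ) :* v) :- (c :* u′ :+ (:- δ) :* u)) refl
        (+ 1 / suc k) δ (seq (s ^ᵣ k) n) (seq (t ^ᵣ k) n) (seq (s ^ᵣ suc k) n) (seq (t ^ᵣ suc k) n))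
      (termwise λ n → solve 3 (λ u v d → v :* d :- (v :- u) :* d := u :* d) refl
        (seq (s ^ᵣ k) n) (seq (t ^ᵣ k) n) (seq (t -ᵣ s) n))
      (-ᵣ-mono-≤ᵣ (increment-upper k) spread))
    (*ᵣ-monoʳ-≤ᵣ 0≤Δ (^ᵣ-monoˡ-≤ᵣ 0≤s s≤τ k))

sum-≤-telescope : ∀ {n} (g : Fin n → ℝ) (Φ : Fin (suc n) → ℝ) →
                  (∀ i → g i ≤ᵣ Φ (fsuc i) -ᵣ Φ (inject₁ i)) → sumᵣ g ≤ᵣ Φ (fromℕ n) -ᵣ Φ fzero
sum-≤-telescope {zero}  g Φ le = ≤ᵣ-reflexive (R.sym (R.-‿inverseʳ (Φ fzero)))
sum-≤-telescope {suc n} g Φ le = ≤ᵣ-resp-≈ᵣ R.refl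
  (termwise λ m → solve 3 (λ a b c → (b :- a) :+ (c :- b) := c :- a) refl
    (seq (Φ fzero) m) (seq (Φ (fsuc fzero)) m) (seq (Φ (fromℕ (suc n))) m))
  (+ᵣ-mono-≤ᵣ (le fzero) (sum-≤-telescope (λ i → g (fsuc i)) (λ i → Φ (fsuc i)) (λ i → le (fsuc i))))
  where open +-*-Solver

telescope-≤-sum : ∀ {n} (g : Fin n → ℝ) (Φ : Fin (suc n) → ℝ) →
                  (∀ i → Φ (fsuc i) -ᵣ Φ (inject₁ i) ≤ᵣ g i) → Φ (fromℕ n) -ᵣ Φ fzero ≤ᵣ sumᵣ g
telescope-≤-sum {zero}  g Φ le = ≤ᵣ-reflexive (R.-‿inverseʳ (Φ fzero))
telescope-≤-sum {suc n} g Φ le = ≤ᵣ-resp-≈ᵣ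
  (termwise λ m → solve 3 (λ a b c → (b :- a) :+ (c :- b) := c :- a) refl
    (seq (Φ fzero) m) (seq (Φ (fsuc fzero)) m) (seq (Φ (fromℕ (suc n))) m))
  R.refl
  (+ᵣ-mono-≤ᵣ (le fzero) (telescope-≤-sum (λ i → g (fsuc i)) (λ i → Φ (fsuc i)) (λ i → le (fsuc i))))
  where open +-*-Solver

1^ᵣk≈1 : ∀ k → 1ᵣ ^ᵣ k ≈ᵣ 1ᵣ
1^ᵣk≈1 zero    = R.refl
1^ᵣk≈1 (suc k) = R.trans (R.*-identityˡ _) (1^ᵣk≈1 k)

module PowerRiemannSum {n} (P : TaggedPartition n) where
  open TaggedPartition P using (point; tag; start; end; left; right)

  point-nonNeg : ∀ i → 0ᵣ ≤ᵣ point i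
  point-nonNeg i = go point (λ i → ≤ᵣ-trans (left i) (right i)) (≤ᵣ-reflexive (R.sym start)) i
    where
    -- The induction drops the first point, after which the sequence need not start at 0; so only
    -- monotonicity and a nonnegative first point are kept.
    go : ∀ {m} (p : Fin (suc m) → ℝ) → (∀ i → p (inject₁ i) ≤ᵣ p (fsuc i)) → 0ᵣ ≤ᵣ p fzero → ∀ i → 0ᵣ ≤ᵣ p i
    go p mono 0≤p₀ fzero = 0≤p₀
    go {suc m} p mono 0≤p₀ (fsuc i) =
      go (λ i → p (fsuc i)) (λ i → mono (fsuc i)) (≤ᵣ-trans 0≤p₀ (mono fzero)) i

  total : ℕ → ℝ
  total k = sumᵣ λ i → tag i ^ᵣ k *ᵣ (point (fsuc i) -ᵣ point (inject₁ i))

  antiderivative-end : ∀ k δ → antiderivative k δ (point (fromℕ n)) ≈ᵣ fromℚ (+ 1 / suc k) +ᵣ fromℚ δ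
  antiderivative-end k δ = R.+-cong (one (+ 1 / suc k) (suc k)) (one δ k)
    where
    one : ∀ q j → fromℚ q *ᵣ point (fromℕ n) ^ᵣ j ≈ᵣ fromℚ q
    one q j = R.trans (R.*-congˡ (R.trans (^ᵣ-congˡ j end) (1^ᵣk≈1 j))) (R.*-identityʳ _)

  -- The δ-term has to stay: 0⁰ = 1, so for `k = 0` it equals δ and not 0.
  antiderivative-start : ∀ k δ → antiderivative k δ (point fzero) ≈ᵣ fromℚ δ *ᵣ point fzero ^ᵣ k
  antiderivative-start k δ = R.trans
    (R.+-congʳ (R.trans (R.*-congˡ (R.trans (R.*-congʳ start) (R.zeroˡ _))) (R.zeroʳ _)))
    (R.+-identityˡ _)

  -- By telescoping, the sum lies between the increments over [0,1] of `antiderivative k (ℚ.- δ)`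
  -- and `antiderivative k δ`. Their values at 1 are 1/(k+1) - δ and 1/(k+1) + δ; by `corner` their
  -- values at 0 have the sign that allows dropping them.
  total-error : ∀ {δ} → 0ℚ ℚ.< δ → MeshAtMost P δ → ∀ k →
                  -ᵣ fromℚ δ ≤ᵣ total k -ᵣ fromℚ (+ 1 / suc k) × total k -ᵣ fromℚ (+ 1 / suc k) ≤ᵣ fromℚ δ
  total-error {δ} 0<δ mesh k = lower , upper
    where
    c = fromℚ (+ 1 / suc k)
    open +-*-Solver

    corner : 0ᵣ ≤ᵣ fromℚ δ *ᵣ point fzero ^ᵣ k
    corner = *ᵣ-nonNeg (fromℚ-mono (ℚP.<⇒≤ 0<δ)) (^ᵣ-nonNeg (point-nonNeg fzero) k)

    upper : total k -ᵣ c ≤ᵣ fromℚ δ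
    upper = ≤ᵣ-resp-≈ᵣ R.refl
      (termwise λ _ → solve 2 (λ c δ → ((c :+ δ) :- con 0ℚ) :- c := δ) refl (+ 1 / suc k) δ)
      (-ᵣ-mono-≤ᵣ (≤ᵣ-trans
        (sum-≤-telescope _ (λ i → antiderivative k δ (point i))
          λ i → term-upper (point-nonNeg (inject₁ i)) (left i) (right i) (mesh i) k)
        (-ᵣ-mono-≤ᵣ (≤ᵣ-reflexive (antiderivative-end k δ))
          (≤ᵣ-resp-≈ᵣ R.refl (R.sym (antiderivative-start k δ)) corner)))
        ≤ᵣ-refl)

    lower : -ᵣ fromℚ δ ≤ᵣ total k -ᵣ c
    lower = ≤ᵣ-resp-≈ᵣ
      (termwise λ _ → solve 2 (λ c δ → ((c :+ (:- δ)) :- con 0ℚ) :- c := :- δ) refl (+ 1 / suc k) δ)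
      R.refl
      (-ᵣ-mono-≤ᵣ (≤ᵣ-trans
        (-ᵣ-mono-≤ᵣ (≤ᵣ-reflexive (R.sym (antiderivative-end k (ℚ.- δ))))
          (≤ᵣ-resp-≈ᵣ
            (R.trans
              (termwise λ m → solve 2 (λ δ u → con 0ℚ :- δ :* u := (:- δ) :* u) refl δ (seq (point fzero ^ᵣ k) m))
              (R.sym (antiderivative-start k (ℚ.- δ))))
            (R.-‿inverseʳ 0ᵣ)
            (-ᵣ-mono-≤ᵣ ≤ᵣ-refl corner)))
        (telescope-≤-sum _ (λ i → antiderivative k (ℚ.- δ) (point i))
          λ i → term-lower (point-nonNeg (inject₁ i)) (left i) (right i) (mesh i) k))
        ≤ᵣ-refl)

-- From [0,1] to the segment from 0 to x

fromℝ-* : ∀ a b → fromℝ (a *ᵣ b) ≈ fromℝ a * fromℝ b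
fromℝ-* a b =
  termwise (λ n → solve 2 (λ a b → a :* b := a :* b :- con 0ℚ :* con 0ℚ) refl (seq a n) (seq b n)) ,ᶜ
  termwise (λ n → solve 2 (λ a b → con 0ℚ := a :* con 0ℚ :+ con 0ℚ :* b) refl (seq a n) (seq b n))
  where open +-*-Solver

fromℝ-- : ∀ a b → fromℝ (a -ᵣ b) ≈ fromℝ a - fromℝ b
fromℝ-- a b = R.refl ,ᶜ R.sym (R.-‿inverseʳ 0ᵣ)

fromℝ-^ : ∀ a k → fromℝ (a ^ᵣ k) ≈ fromℝ a ^ k
fromℝ-^ a zero    = C.refl
fromℝ-^ a (suc k) = C.trans (fromℝ-* a (a ^ᵣ k)) (C.*-congˡ (fromℝ-^ a k))

fromℝ-sum : ∀ {n} (f : Fin n → ℝ) → fromℝ (sumᵣ f) ≈ sum (λ i → fromℝ (f i))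
fromℝ-sum {zero}  f = C.refl
fromℝ-sum {suc n} f = C.trans (R.refl ,ᶜ R.sym (R.+-identityˡ 0ᵣ)) (C.+-congˡ (fromℝ-sum (λ i → f (fsuc i))))

∥fromℝ∥ : ∀ r {δ} → -ᵣ fromℚ δ ≤ᵣ r → r ≤ᵣ fromℚ δ → ∥ fromℝ r ∥≤ δ
∥fromℝ∥ r -δ≤r r≤δ = ≤ᵣ-resp-≈ᵣ
  (R.sym (R.trans (R.+-congˡ (R.zeroˡ 0ᵣ)) (R.+-identityʳ _)))
  (termwise λ _ → refl)
  (square-≤ᵣ -δ≤r r≤δ)

segment-0 : ∀ x s → segment 0# x s ≈ x * fromℝ s
segment-0 x s = C.trans (C.+-identityˡ _) (C.trans
  (C.*-congˡ (C.trans (C.+-congˡ -0#≈0#) (C.+-identityʳ x)))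
  (C.*-comm (fromℝ s) x))

-- The point with parameter τ is xτ, so the power contributes xᵏ and the increment one more factor
-- x.
power-term : ∀ x k τ s t →
  segment 0# x τ ^ k * (segment 0# x t - segment 0# x s) ≈ x ^ suc k * fromℝ (τ ^ᵣ k *ᵣ (t -ᵣ s))
power-term x k τ s t = begin
  segment 0# x τ ^ k * (segment 0# x t - segment 0# x s)
    ≈⟨ C.*-cong
         (C.trans (^-congˡ k (segment-0 x τ)) (^-distrib-* x (fromℝ τ) k))
         (C.trans (C.+-cong (segment-0 x t) (C.-‿cong (segment-0 x s)))
           (C.sym (x[y-z]≈xy-xz x (fromℝ t) (fromℝ s)))) ⟩
  (x ^ k * fromℝ τ ^ k) * (x * (fromℝ t - fromℝ s))
    ≈⟨ *-Solver.solve 4 (λ a b c d → (a *-Solver.⊕ b) *-Solver.⊕ (c *-Solver.⊕ d)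
                           *-Solver.⊜ (c *-Solver.⊕ a) *-Solver.⊕ (b *-Solver.⊕ d)) C.refl
         (x ^ k) (fromℝ τ ^ k) x (fromℝ t - fromℝ s) ⟩
  x ^ suc k * (fromℝ τ ^ k * (fromℝ t - fromℝ s))
    ≈⟨ C.*-congˡ (C.*-cong (C.sym (fromℝ-^ τ k)) (C.sym (fromℝ-- t s))) ⟩
  x ^ suc k * (fromℝ (τ ^ᵣ k) * fromℝ (t -ᵣ s))
    ≈⟨ C.*-congˡ (C.sym (fromℝ-* (τ ^ᵣ k) (t -ᵣ s))) ⟩
  x ^ suc k * fromℝ (τ ^ᵣ k *ᵣ (t -ᵣ s)) ∎
  where open import Relation.Binary.Reasoning.Setoid C.setoid

-- Integrals of powers and polynomials

module Mesh = Limits finePartitions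

total-Tends : ∀ k → Mesh.Tends (λ (_ , P) → fromℝ (PowerRiemannSum.total P k)) (fromℚᶜ (+ 1 / suc k))
-- The error is at most the mesh bound, so ε itself serves as δ.
total-Tends k = Mesh.tends λ ε 0<ε → (ε , 0<ε) , λ (_ , P) mesh →
  let lower , upper = PowerRiemannSum.total-error P 0<ε mesh k
  in ∥∥-cong ε (fromℝ-- (PowerRiemannSum.total P k) (fromℚ (+ 1 / suc k)))
       (∥fromℝ∥ (PowerRiemannSum.total P k -ᵣ fromℚ (+ 1 / suc k)) lower upper)

riemannSum-power : ∀ x k {n} (P : TaggedPartition n) →
  riemannSum (_^ k) (segment 0# x) P ≈ x ^ suc k * fromℝ (PowerRiemannSum.total P k)
riemannSum-power x k {n} P = C.trans
  (sum-cong-≋ {n} λ i → power-term x k (tag i) (point (inject₁ i)) (point (fsuc i)))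
  (C.trans
    (C.sym (*-distribˡ-sum {n} (x ^ suc k) _))
    (C.*-congˡ (C.sym (fromℝ-sum {n} _))))
  where open TaggedPartition P

power-integral : ∀ x k →
  Mesh.Tends (λ (_ , P) → riemannSum (_^ k) (segment 0# x) P) (x ^ suc k * fromℚᶜ (+ 1 / suc k))
power-integral x k = Mesh.Tends-cong
  (λ (_ , P) → C.sym (riemannSum-power x k P)) C.refl (Mesh.Tends-*ˡ (x ^ suc k) (total-Tends k))

riemannSum-polynomial : ∀ {m n} (c : Fin m → ℂ) γ (P : TaggedPartition n) →
  riemannSum (λ t → ∑[ j < m ] (c j * t ^ toℕ j)) γ P ≈ ∑[ j < m ] (c j * riemannSum (_^ toℕ j) γ P)
riemannSum-polynomial {m} {n} c γ P = begin
  ∑[ i < n ] ((∑[ j < m ] (c j * γ (tag i) ^ toℕ j)) * Δ i)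
    ≈⟨ sum-cong-≋ {n} (λ i → *-distribʳ-sum {m} (Δ i) (λ j → c j * γ (tag i) ^ toℕ j)) ⟩
  ∑[ i < n ] ∑[ j < m ] ((c j * γ (tag i) ^ toℕ j) * Δ i)
    ≈⟨ ∑-comm {n} {m} (λ i j → (c j * γ (tag i) ^ toℕ j) * Δ i) ⟩
  ∑[ j < m ] ∑[ i < n ] ((c j * γ (tag i) ^ toℕ j) * Δ i)
    ≈⟨ sum-cong-≋ {m} (λ j → C.trans
         (sum-cong-≋ {n} (λ i → C.*-assoc (c j) (γ (tag i) ^ toℕ j) (Δ i)))
         (C.sym (*-distribˡ-sum {n} (c j) (λ i → γ (tag i) ^ toℕ j * Δ i)))) ⟩
  ∑[ j < m ] (c j * riemannSum (_^ toℕ j) γ P) ∎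
  where
  open TaggedPartition P
  open import Relation.Binary.Reasoning.Setoid C.setoid
  Δ : Fin n → ℂ
  Δ i = γ (point (fsuc i)) - γ (point (inject₁ i))

polynomial-integral : ∀ {m} (c : Fin m → ℂ) x →
  SegmentIntegral (λ t → ∑[ j < m ] (c j * t ^ toℕ j)) 0# x
    (∑[ j < m ] (fromℚᶜ (+ 1 / suc (toℕ j)) * c j * x ^ suc (toℕ j)))
polynomial-integral {m} c x ε 0<ε =
  let (δ , 0<δ) , close = Mesh.stage limit ε 0<ε in δ , 0<δ , λ P → close (_ , P)
  where
  limit : Mesh.Tends (λ (_ , P) → riemannSum (λ t → ∑[ j < m ] (c j * t ^ toℕ j)) (segment 0# x) P)
                (∑[ j < m ] (fromℚᶜ (+ 1 / suc (toℕ j)) * c j * x ^ suc (toℕ j)))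
  limit = Mesh.Tends-cong
    (λ (_ , P) → C.sym (riemannSum-polynomial c (segment 0# x) P))
    (sum-cong-≋ {m} λ j → *-Solver.solve 3
      (λ a b c → a *-Solver.⊕ (b *-Solver.⊕ c) *-Solver.⊜ (c *-Solver.⊕ a) *-Solver.⊕ b) C.refl
      (c j) (x ^ suc (toℕ j)) (fromℚᶜ (+ 1 / suc (toℕ j))))
    (Mesh.Tends-sum λ j → Mesh.Tends-*ˡ (c j) (power-integral x (toℕ j)))

-- Power sums and Stirling numbers

infixl 8 _↓_

-- The falling factorial n(n-1)…(n-k+1).
_↓_ : ℕ → ℕ → ℕ
n     ↓ zero  = 1
zero  ↓ suc k = 0
suc n ↓ suc k = suc n ℕ.* n ↓ k

-- A subtraction-free form of n ↓ (k+1) = (n - k)(n ↓ k). As the left side is also (n+1) ↓ (k+1), it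
-- is a Pascal rule for falling factorials.
↓-suc : ∀ n k → suc n ℕ.* n ↓ k ≡ suc k ℕ.* n ↓ k ℕ.+ n ↓ suc k
↓-suc zero    zero    = refl
↓-suc zero    (suc k) = sym (trans (ℕP.+-identityʳ _) (ℕP.*-zeroʳ (suc (suc k))))
↓-suc (suc n) zero    = refl
↓-suc (suc n) (suc k) = begin
  suc (suc n) ℕ.* (suc n ℕ.* n ↓ k)
    ≡⟨⟩
  suc n ℕ.* n ↓ k ℕ.+ suc n ℕ.* (suc n ℕ.* n ↓ k)
    ≡⟨ cong (λ m → suc n ℕ.* n ↓ k ℕ.+ suc n ℕ.* m) (↓-suc n k) ⟩
  suc n ℕ.* n ↓ k ℕ.+ suc n ℕ.* (suc k ℕ.* n ↓ k ℕ.+ n ↓ suc k)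
    ≡⟨ solve 4 (λ n k a b → n :* a :+ n :* (k :* a :+ b) := (con 1 :+ k) :* (n :* a) :+ n :* b) refl
         (suc n) (suc k) (n ↓ k) (n ↓ suc k) ⟩
  suc (suc k) ℕ.* (suc n ℕ.* n ↓ k) ℕ.+ suc n ℕ.* n ↓ suc k ∎
  where
  open ≡-Reasoning
  open ℕ-Solver.+-*-Solver

stirling-> : ∀ {m k} → m ℕ.< k → stirling m k ≡ 0
stirling-> {zero}  {suc k} _           = refl
stirling-> {suc m} {suc k} (ℕ.s≤s m<k) = trans
  (cong₂ ℕ._+_ (cong (suc k ℕ.*_) (stirling-> (ℕP.m≤n⇒m≤1+n m<k))) (stirling-> m<k))
  (trans (ℕP.+-identityʳ _) (ℕP.*-zeroʳ (suc k)))

sumℕ-last : ∀ (f : ℕ → ℕ) n → sumℕ {suc n} (λ j → f (toℕ j)) ≡ sumℕ {n} (λ j → f (toℕ j)) ℕ.+ f n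
sumℕ-last f zero    = ℕP.+-identityʳ (f 0)
sumℕ-last f (suc n) = trans (cong (f 0 ℕ.+_) (sumℕ-last (λ j → f (suc j)) n)) (sym (ℕP.+-assoc (f 0) _ _))

-- This is the classical expansion of N^(p+1) in falling factorials of N = n + 1, with the common
-- factor N cancelled. In the induction the Stirling recurrence splits each term in two, and `↓-suc`
-- recombines the parts with a factor n + 1.
^-stirling : ∀ p n → sumℕ {suc p} (λ j → stirling (suc p) (suc (toℕ j)) ℕ.* n ↓ toℕ j) ≡ suc n ℕ.^ p
^-stirling zero    n = refl
^-stirling (suc p) n = begin
  sumℕ {suc (suc p)} (λ j → (suc (toℕ j) ℕ.* S (suc (toℕ j)) ℕ.+ S (toℕ j)) ℕ.* n ↓ toℕ j)
    ≡⟨ sumℕ-cong {suc (suc p)} (λ j → ℕP.*-distribʳ-+ (n ↓ toℕ j) (suc (toℕ j) ℕ.* S (suc (toℕ j))) (S (toℕ j))) ⟩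
  sumℕ {suc (suc p)} (λ j → u (toℕ j) ℕ.+ S (toℕ j) ℕ.* n ↓ toℕ j)
    ≡⟨ sumℕ-distrib-+ {suc (suc p)} (λ j → u (toℕ j)) (λ j → S (toℕ j) ℕ.* n ↓ toℕ j) ⟩
  sumℕ {suc (suc p)} (λ j → u (toℕ j)) ℕ.+ sumℕ {suc p} (λ j → v (toℕ j))
    -- The second sum has already lost its first term by computation, as S(p+1,0) = 0; here the
    -- first loses its last, as S(p+1,p+2) = 0. Both then range over j ≤ p.
    ≡⟨ cong (ℕ._+ sumℕ {suc p} (λ j → v (toℕ j))) (trans (sumℕ-last u (suc p))
         (trans (cong (sumℕ {suc p} (λ j → u (toℕ j)) ℕ.+_) u-top) (ℕP.+-identityʳ _))) ⟩
  sumℕ {suc p} (λ j → u (toℕ j)) ℕ.+ sumℕ {suc p} (λ j → v (toℕ j))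
    ≡⟨ sumℕ-distrib-+ {suc p} (λ j → u (toℕ j)) (λ j → v (toℕ j)) ⟨
  sumℕ {suc p} (λ j → u (toℕ j) ℕ.+ v (toℕ j))
    ≡⟨ sumℕ-cong {suc p} (λ j → combine (toℕ j)) ⟩
  sumℕ {suc p} (λ j → suc n ℕ.* (S (suc (toℕ j)) ℕ.* n ↓ toℕ j))
    ≡⟨ *-distribˡ-sumℕ {suc p} (suc n) (λ j → S (suc (toℕ j)) ℕ.* n ↓ toℕ j) ⟨
  suc n ℕ.* sumℕ {suc p} (λ j → S (suc (toℕ j)) ℕ.* n ↓ toℕ j)
    ≡⟨ cong (suc n ℕ.*_) (^-stirling p n) ⟩
  suc n ℕ.* suc n ℕ.^ p ∎
  where
  open ≡-Reasoning
  open ℕ-Solver.+-*-Solver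
  S : ℕ → ℕ
  S = stirling (suc p)
  u v : ℕ → ℕ
  u j = (suc j ℕ.* S (suc j)) ℕ.* n ↓ j
  v j = S (suc j) ℕ.* n ↓ suc j
  u-top : u (suc p) ≡ 0
  u-top = cong (ℕ._* n ↓ suc p)
    (trans (cong (suc (suc p) ℕ.*_) (stirling-> (ℕP.n<1+n (suc p)))) (ℕP.*-zeroʳ (suc (suc p))))
  combine : ∀ j → u j ℕ.+ v j ≡ suc n ℕ.* (S (suc j) ℕ.* n ↓ j)
  combine j = begin
    u j ℕ.+ v j
      ≡⟨ solve 4 (λ k s a b → (k :* s) :* a :+ s :* b := s :* (k :* a :+ b)) refl (suc j) (S (suc j)) (n ↓ j) (n ↓ suc j) ⟩
    S (suc j) ℕ.* (suc j ℕ.* n ↓ j ℕ.+ n ↓ suc j)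
      ≡⟨ cong (S (suc j) ℕ.*_) (↓-suc n j) ⟨
    S (suc j) ℕ.* (suc n ℕ.* n ↓ j)
      ≡⟨ solve 3 (λ n s a → s :* (n :* a) := n :* (s :* a)) refl (suc n) (S (suc j)) (n ↓ j) ⟩
    suc n ℕ.* (S (suc j) ℕ.* n ↓ j) ∎

∑↓ : ℕ → ℕ → ℕ
∑↓ zero    k = 0
∑↓ (suc n) k = ∑↓ n k ℕ.+ n ↓ k

-- The discrete analogue of integrating tᵏ, multiplied by k + 1 to stay in ℕ. The inductive step is
-- the Pascal rule `↓-suc`.
suc*∑↓ : ∀ n k → suc k ℕ.* ∑↓ n k ≡ n ↓ suc k
suc*∑↓ zero    k = ℕP.*-zeroʳ (suc k)
suc*∑↓ (suc n) k = begin
  suc k ℕ.* (∑↓ n k ℕ.+ n ↓ k)         ≡⟨ ℕP.*-distribˡ-+ (suc k) (∑↓ n k) (n ↓ k) ⟩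
  suc k ℕ.* ∑↓ n k ℕ.+ suc k ℕ.* n ↓ k ≡⟨ cong (ℕ._+ suc k ℕ.* n ↓ k) (suc*∑↓ n k) ⟩
  n ↓ suc k ℕ.+ suc k ℕ.* n ↓ k        ≡⟨ ℕP.+-comm (n ↓ suc k) (suc k ℕ.* n ↓ k) ⟩
  suc k ℕ.* n ↓ k ℕ.+ n ↓ suc k        ≡⟨ ↓-suc n k ⟨
  suc n ℕ.* n ↓ k                      ∎
  where open ≡-Reasoning

-- Adds up `^-stirling` at 0, 1, ..., n-1.
powerSum-stirling : ∀ p n → sumℕ {suc p} (λ j → stirling (suc p) (suc (toℕ j)) ℕ.* ∑↓ n (toℕ j)) ≡ powerSum p n
powerSum-stirling p zero = trans
  (sumℕ-cong {suc p} (λ j → ℕP.*-zeroʳ (stirling (suc p) (suc (toℕ j))))) (sumℕ-zero (suc p))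
powerSum-stirling p (suc n) = trans
  (sumℕ-cong {suc p} (λ j → ℕP.*-distribˡ-+ (stirling (suc p) (suc (toℕ j))) (∑↓ n (toℕ j)) (n ↓ toℕ j)))
  (trans
    (sumℕ-distrib-+ {suc p}
      (λ j → stirling (suc p) (suc (toℕ j)) ℕ.* ∑↓ n (toℕ j))
      (λ j → stirling (suc p) (suc (toℕ j)) ℕ.* n ↓ toℕ j))
    (cong₂ ℕ._+_ (powerSum-stirling p n) (^-stirling p n)))

-- The series M(x,p)

fromℕᶜ-+ : ∀ m n → fromℕᶜ (m ℕ.+ n) ≈ fromℕᶜ m + fromℕᶜ n
fromℕᶜ-+ m n = termwise (λ _ → ℕ/1-+ m n) ,ᶜ R.sym (R.+-identityˡ 0ᵣ)

fromℚᶜ-* : ∀ p q → fromℚᶜ (p ℚ.* q) ≈ fromℚᶜ p * fromℚᶜ q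
fromℚᶜ-* p q = C.trans (termwise (λ _ → refl) ,ᶜ R.refl) (fromℝ-* (fromℚ p) (fromℚ q))

fromℕᶜ-* : ∀ m n → fromℕᶜ (m ℕ.* n) ≈ fromℕᶜ m * fromℕᶜ n
fromℕᶜ-* m n = C.trans (C.reflexive (cong fromℚᶜ (ℕ/1-* m n))) (fromℚᶜ-* (+ m / 1) (+ n / 1))

fromℕᶜ-sum : ∀ {n} (f : Fin n → ℕ) → fromℕᶜ (sumℕ f) ≈ sum (λ i → fromℕᶜ (f i))
fromℕᶜ-sum {zero}  f = C.refl
fromℕᶜ-sum {suc n} f = C.trans (fromℕᶜ-+ (f fzero) _) (C.+-congˡ (fromℕᶜ-sum (λ i → f (fsuc i))))

1/n*n≈1 : ∀ n → fromℚᶜ (+ 1 / suc n) * fromℕᶜ (suc n) ≈ 1#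
1/n*n≈1 n = C.trans (C.sym (fromℚᶜ-* (+ 1 / suc n) (+ suc n / 1))) (C.reflexive (cong fromℚᶜ (1/n*n≡1 n)))

expTerm-suc : ∀ x n → fromℕᶜ (suc n) * expTerm x (suc n) ≈ x * expTerm x n
expTerm-suc x n = begin
  fromℕᶜ (suc n) * (fromℚᶜ (invFact (suc n)) * (x * x ^ n))
    ≈⟨ C.*-congˡ (C.*-congʳ (C.trans
         (C.reflexive (cong fromℚᶜ (ExpConvergence.invFact-suc x n)))
         (fromℚᶜ-* (+ 1 / suc n) (invFact n)))) ⟩
  fromℕᶜ (suc n) * ((fromℚᶜ (+ 1 / suc n) * fromℚᶜ (invFact n)) * (x * x ^ n))
    ≈⟨ solve 5 (λ a b c d e → a ⊕ ((b ⊕ c) ⊕ (d ⊕ e)) ⊜ (b ⊕ a) ⊕ (d ⊕ (c ⊕ e))) C.refl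
         (fromℕᶜ (suc n)) (fromℚᶜ (+ 1 / suc n)) (fromℚᶜ (invFact n)) x (x ^ n) ⟩
  (fromℚᶜ (+ 1 / suc n) * fromℕᶜ (suc n)) * (x * expTerm x n)
    ≈⟨ C.*-congʳ (1/n*n≈1 n) ⟩
  1# * (x * expTerm x n)
    ≈⟨ C.*-identityˡ _ ⟩
  x * expTerm x n ∎
  where
  open import Relation.Binary.Reasoning.Setoid C.setoid
  open *-Solver

-- Delayed copies of the exponential series

delay : (ℕ → ℂ) → ℕ → ℂ
delay f zero    = 0#
delay f (suc n) = f n

shift : ℕ → (ℕ → ℂ) → ℕ → ℂ
shift zero    f = f
shift (suc j) f = delay (shift j f)

-- `shift j (expTerm x) n` stands for xⁿ⁻ʲ/(n-j)!, read as 0 when n < j, so that no truncated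
-- subtraction occurs. In that case n ↓ j vanishes too.
shift-expTerm : ∀ x j n → x ^ j * shift j (expTerm x) n ≈ fromℕᶜ (n ↓ j) * expTerm x n
shift-expTerm x zero    n       = C.refl
shift-expTerm x (suc j) zero    = C.trans (C.zeroʳ _) (C.sym (C.zeroˡ _))
shift-expTerm x (suc j) (suc n) = begin
  (x * x ^ j) * shift j (expTerm x) n
    ≈⟨ C.*-assoc x (x ^ j) _ ⟩
  x * (x ^ j * shift j (expTerm x) n)
    ≈⟨ C.*-congˡ (shift-expTerm x j n) ⟩
  x * (fromℕᶜ (n ↓ j) * expTerm x n)
    ≈⟨ solve 3 (λ a b c → a ⊕ (b ⊕ c) ⊜ b ⊕ (a ⊕ c)) C.refl x (fromℕᶜ (n ↓ j)) (expTerm x n) ⟩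
  fromℕᶜ (n ↓ j) * (x * expTerm x n)
    ≈⟨ C.*-congˡ (expTerm-suc x n) ⟨
  fromℕᶜ (n ↓ j) * (fromℕᶜ (suc n) * expTerm x (suc n))
    ≈⟨ solve 3 (λ a b c → a ⊕ (b ⊕ c) ⊜ (b ⊕ a) ⊕ c) C.refl
         (fromℕᶜ (n ↓ j)) (fromℕᶜ (suc n)) (expTerm x (suc n)) ⟩
  (fromℕᶜ (suc n) * fromℕᶜ (n ↓ j)) * expTerm x (suc n)
    ≈⟨ C.*-congʳ (fromℕᶜ-* (suc n) (n ↓ j)) ⟨
  fromℕᶜ (suc n ↓ suc j) * expTerm x (suc n) ∎
  where
  open import Relation.Binary.Reasoning.Setoid C.setoid
  open *-Solver

-- The term of the closed form with index k = j + 1.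
coefficient : ℂ → ℕ → ℕ → ℂ
coefficient x p j = fromℚᶜ (+ 1 / suc j) * fromℕᶜ (stirling (suc p) (suc j)) * x ^ suc j

coefficient*shift : ∀ x p j n → coefficient x p j * shift j (expTerm x) n ≈
                    fromℕᶜ (stirling (suc p) (suc j) ℕ.* ∑↓ (suc n) j) * expTerm x (suc n)
coefficient*shift x p j n = begin
  -- `shift (suc j) f (suc n)` computes to `shift j f n`. The extra delay matches the power j + 1 of
  -- x, and absorbs the fact that M(x,p) starts at index 1.
  (q * s * x ^ suc j) * shift (suc j) (expTerm x) (suc n)
    ≈⟨ C.*-assoc (q * s) (x ^ suc j) _ ⟩
  (q * s) * (x ^ suc j * shift (suc j) (expTerm x) (suc n))
    ≈⟨ C.*-congˡ (shift-expTerm x (suc j) (suc n)) ⟩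
  (q * s) * (fromℕᶜ (suc n ↓ suc j) * e)
    -- Exposes a factor j + 1 that cancels the 1/(j+1) in `q`.
    ≈⟨ C.*-congˡ (C.*-congʳ (C.trans
         (C.reflexive (cong fromℕᶜ (sym (suc*∑↓ (suc n) j))))
         (fromℕᶜ-* (suc j) (∑↓ (suc n) j)))) ⟩
  (q * s) * ((fromℕᶜ (suc j) * g) * e)
    ≈⟨ solve 5 (λ q s m g e → (q ⊕ s) ⊕ ((m ⊕ g) ⊕ e) ⊜ (q ⊕ m) ⊕ ((s ⊕ g) ⊕ e)) C.refl
         q s (fromℕᶜ (suc j)) g e ⟩
  (q * fromℕᶜ (suc j)) * ((s * g) * e)
    ≈⟨ C.*-congʳ (1/n*n≈1 j) ⟩
  1# * ((s * g) * e)
    ≈⟨ C.*-identityˡ _ ⟩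
  (s * g) * e
    ≈⟨ C.*-congʳ (fromℕᶜ-* (stirling (suc p) (suc j)) (∑↓ (suc n) j)) ⟨
  fromℕᶜ (stirling (suc p) (suc j) ℕ.* ∑↓ (suc n) j) * e ∎
  where
  open import Relation.Binary.Reasoning.Setoid C.setoid
  open *-Solver
  q = fromℚᶜ (+ 1 / suc j)
  s = fromℕᶜ (stirling (suc p) (suc j))
  g = fromℕᶜ (∑↓ (suc n) j)
  e = expTerm x (suc n)

MTerm-shift : ∀ x p n → ∑[ j ≤ p ] (coefficient x p (toℕ j) * shift (toℕ j) (expTerm x) n) ≈ MTerm x p (suc n)
MTerm-shift x p n = C.trans
  (sum-cong-≋ {suc p} (λ j → coefficient*shift x p (toℕ j) n))
  (C.trans (C.sym (*-distribʳ-sum {suc p} (expTerm x (suc n)) (λ j → fromℕᶜ (term j))))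
    (C.*-congʳ (C.trans (C.sym (fromℕᶜ-sum {suc p} term))
      (C.reflexive (cong fromℕᶜ (powerSum-stirling p (suc n)))))))
  where
  term : Fin (suc p) → ℕ
  term j = stirling (suc p) (suc (toℕ j)) ℕ.* ∑↓ (suc n) (toℕ j)

-- Convergence of the series

module Seq = Limits atInfinity

-- A delay merely moves the partial sums by one index, so the threshold N becomes N + 1 and the
-- limit stays.
partialSum-delay : ∀ {f l} → Seq.Tends (partialSum f) l → Seq.Tends (partialSum (delay f)) l
partialSum-delay {f} {l} p = Seq.tends λ ε 0<ε →
  let N , q = Seq.stage p ε 0<ε
  in suc N , λ { (suc n) (ℕ.s≤s N≤n) → ∥∥-cong ε (C.+-congʳ {C.- l} (C.sym (C.+-identityˡ (partialSum f n)))) (q n N≤n) }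

partialSum-shift : ∀ {f l} j → Seq.Tends (partialSum f) l → Seq.Tends (partialSum (shift j f)) l
partialSum-shift zero    p = p
partialSum-shift (suc j) p = partialSum-delay (partialSum-shift j p)

partialSum-linear : ∀ {m} (a : Fin m → ℂ) (u : Fin m → ℕ → ℂ) n →
  ∑[ j < m ] (a j * partialSum (u j) n) ≈ partialSum (λ k → ∑[ j < m ] (a j * u j k)) n
partialSum-linear {m} a u n = C.trans
  (sum-cong-≋ {m} (λ j → *-distribˡ-sum {n} (a j) (λ k → u j (toℕ k))))
  (∑-comm {m} {n} (λ j k → a j * u j (toℕ k)))

-- By `MTerm-shift` the partial sums are combinations of those of p + 1 delayed exponential series,
-- each tending to `exp x`, which therefore factors out.
MTerm-sum : ∀ x p → SumsTo (λ n → MTerm x p (suc n)) (exp x * ∑[ j ≤ p ] coefficient x p (toℕ j))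
MTerm-sum x p = Seq.stage (Seq.Tends-cong
  (λ n → C.trans (partialSum-linear {suc p} (λ j → coefficient x p (toℕ j)) (λ j → shift (toℕ j) (expTerm x)) n) 
    (sum-cong-≋ {n} (λ k → MTerm-shift x p (toℕ k))))
  (C.trans (C.sym (*-distribʳ-sum {suc p} (exp x) (λ j → coefficient x p (toℕ j))))
    (C.*-comm _ (exp x)))
  (Seq.Tends-sum {suc p} λ j → Seq.Tends-*ˡ (coefficient x p (toℕ j)) (partialSum-shift {expTerm x} {exp x} (toℕ j) (Seq.tends (exp-sums x)))))

mainTheorem1 : ∀ (p : ℕ) → 1 ≤ p → ∀ (x : ℂ) →
    ∃ λ (M : ℂ) → ∃ λ (I : ℂ) →
    SumsTo (λ n → MTerm x p (suc n)) M ×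
    SegmentIntegral (φ/t (suc p)) 0# x I ×
    M ≈ exp x * I ×
    exp x * I ≈
    exp x * (∑[ j ≤ p ] (fromℚᶜ (+ 1 / suc (toℕ j)) * fromℕᶜ (stirling (suc p) (suc (toℕ j))) * x ^ suc (toℕ j)))
mainTheorem1 p _ x =
  -- With the closed forms as witnesses both equations hold by reflexivity; the content lies in the
  -- convergence of the series and in the integral.
  exp x * ∑[ j ≤ p ] coefficient x p (toℕ j) ,
  ∑[ j ≤ p ] coefficient x p (toℕ j) ,
  MTerm-sum x p ,
  -- `φ/t (suc p)` is by definition the polynomial with these coefficients.
  polynomial-integral {suc p} (λ j → fromℕᶜ (stirling (suc p) (suc (toℕ j)))) x ,
  C.refl ,
  C.refl
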